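{- Let $\mathcal{A}$ be an antimatroid with height at most two. Then either $\mathcal{A}$ has one or two elements and defines a total order on its elements (i.e., has a single basic word), or it contains a balanced pair.
   Context: An antimatroid is a finite family $\mathcal{A}$ of finite sets that is closed under unions and accessible (for every nonempty $T\in\mathcal{A}$ there is $x\in T$ with $T\setminus\{x\}\in\mathcal{A}$). Its elements are the members of $\bigcup\mathcal{A}$. A path of $\mathcal{A}$ is a set $P\in\mathcal{A}$ such that there is exactly one $x\in P$ with $P\setminus\{x\}\in\mathcal{A}$. The path poset is the set of paths ordered by inclusion, and the height of $\mathcal{A}$ is the height (maximum chain size) of its path poset. A basic word is a permutation of the elements such that the set of elements of every prefix belongs to $\mathcal{A}$. For elements $x\ne y$, $\Pr[x<y]$ is the probability that $x$ precedes $y$ in a uniformly random basic word, and $x,y$ is a balanced pair if $\frac13\le\Pr[x<y]\le\frac23$.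
   Formalization: The antimatroid is assumed to have at least one element, because for the antimatroid whose only set is the empty set (no elements, one empty basic word, no pairs) neither alternative of the statement holds. -}

module Defs where

open import Data.Nat using (ℕ; zero; suc; _*_; _≤_)
open import Data.Bool using (Bool; true; false; if_then_else_)
open import Data.Fin using (Fin)
open import Data.Fin.Properties using () renaming (_≟_ to _≟F_)
open import Data.Fin.Subset using (Subset; _∈_; _∪_; _-_; _⊂_; ⁅_⁆)
import Data.Fin.Subset as Sub
open import Data.List using (List; []; _∷_; length; filter; foldr)
open import Data.List.Relation.Unary.Unique.Propositional using (Unique)
import Data.List.Membership.Propositional as LM
open import Data.Product using (Σ; ∃; _×_; _,_)
open import Relation.Binary.PropositionalEquality using (_≡_; _≢_)
open import Relation.Nullary using (¬_; yes; no)
open import Function.Bundles using (_⇔_)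

Family : ℕ → Set
Family n = Subset n → Bool

module _ {n : ℕ} (𝒜 : Family n) where

  Feasible : Subset n → Set
  Feasible S = 𝒜 S ≡ true

  -- closed under (binary, hence all nonempty finite) unions
  UnionClosed : Set
  UnionClosed = ∀ S T → Feasible S → Feasible T → Feasible (S ∪ T)

  Accessible : Set
  Accessible = ∀ T → Feasible T → (∃ λ y → y ∈ T) →
               ∃ λ x → x ∈ T × Feasible (T - x)

  IsAntimatroid : Set
  IsAntimatroid = UnionClosed × Accessible

  Element : Fin n → Set
  Element x = ∃ λ S → Feasible S × x ∈ S

  IsPath : Subset n → Set
  IsPath P = Feasible P ×
             (∃ λ x → x ∈ P × Feasible (P - x) ×
                      (∀ y → y ∈ P → Feasible (P - y) → y ≡ x))

  HeightAtMostTwo : Set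
  HeightAtMostTwo = ∀ P Q R → IsPath P → IsPath Q → IsPath R →
                    P ⊂ Q → Q ⊂ R → Data.Empty.⊥
    where import Data.Empty

  setOf : List (Fin n) → Subset n
  setOf = foldr (λ x S → ⁅ x ⁆ ∪ S) Sub.⊥

  PrefixesFeasible : List (Fin n) → Set
  PrefixesFeasible w = ∀ u v → u Data.List.++ v ≡ w → Feasible (setOf u)
    where import Data.List

  IsBasicWord : List (Fin n) → Set
  IsBasicWord w = Unique w × (∀ x → (x LM.∈ w) ⇔ Element x) × PrefixesFeasible w

  EnumeratesBasicWords : List (List (Fin n)) → Set
  EnumeratesBasicWords ws = Unique ws × (∀ w → (w LM.∈ ws) ⇔ IsBasicWord w)

precedes : {n : ℕ} → Fin n → Fin n → List (Fin n) → Bool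
precedes x y [] = false
precedes x y (z ∷ w) with z ≟F x | z ≟F y
... | yes _ | _     = true
... | no _  | yes _ = false
... | no _  | no _  = precedes x y w

countBefore : {n : ℕ} → Fin n → Fin n → List (List (Fin n)) → ℕ
countBefore x y ws = length (filter (λ w → precedes x y w Data.Bool.≟ true) ws)
  where import Data.Bool

-- x,y (distinct elements) form a balanced pair w.r.t. the enumeration ws:
-- 1/3 ≤ Pr[x<y] ≤ 2/3, where Pr[x<y] = countBefore x y ws / length ws
BalancedPair : {n : ℕ} (𝒜 : Family n) → List (List (Fin n)) → Fin n → Fin n → Set
BalancedPair 𝒜 ws x y =
  Element 𝒜 x × Element 𝒜 y × x ≢ y ×
  length ws ≤ 3 * countBefore x y ws × 3 * countBefore x y ws ≤ 2 * length ws

{-# OPTIONS --safe #-}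
module Submission where

open import Defs
open import Data.Bool using (Bool; true; false; _∧_)
import Data.Bool as Bool
open import Data.Empty using (⊥; ⊥-elim)
open import Data.Fin using (Fin)
open import Data.Fin.Properties using (_≟_; any?)
open import Data.Fin.Subset using (Subset; ⁅_⁆; _∪_; _-_; _⊆_; ∣_∣) renaming (_∈_ to _∈ₛ_; _∉_ to _∉ₛ_; ⊥ to ⊥ₛ)
open import Data.Fin.Subset.Properties using (x∈⁅x⁆; x∈⁅y⁆⇒x≡y; x∈p∪q⁺; x∈p∪q⁻; ∉⊥; ⊆-antisym; p─q⊆p; x∈p∧x≢y⇒x∈p-y; x∈p⇒∣p-x∣<∣p∣; anySubset?; _∈?_; nonempty?; Empty-unique; ∪-identityʳ)
open import Data.List using (List; []; _∷_; _++_; [_]; length; map; filter; reverse; _∷ʳ_; initLast; _∷ʳ′_; allFin)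
open import Data.List.Membership.Propositional using (_∈_; _∉_)
open import Data.List.Membership.Propositional.Properties using (∈-∃++; ∈-++⁺ˡ; ∈-++⁺ʳ; ∈-++⁻; ∈-allFin; ∈-filter⁺; ∈-filter⁻; ∈-map⁺; ∈-map⁻)
open import Data.List.Membership.Propositional.Properties.WithK using (unique∧set⇒bag)
open import Data.List.Properties using (++-assoc; ++-identityʳ; length-++; length-map; length-reverse; map-∘; ∷-injective; ∷ʳ-++; ∷ʳ-injective; reverse-++; reverse-injective; reverse-involutive; unfold-reverse)
open import Data.List.Relation.Binary.BagAndSetEquality using (∼bag⇒↭)
open import Data.List.Relation.Binary.Permutation.Propositional using (_↭_; ↭-refl; ↭-sym; ↭-trans; prep; swap; ↭⇒↭ₛ)
open import Data.List.Relation.Binary.Permutation.Propositional.Properties using (shift; ↭-length; All-resp-↭; ∈-resp-↭; drop-∷; ↭-reverse; ++⁺ˡ; map⁺; ++-comm; ↭-singleton-inv; ↭-empty-inv)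
import Data.List.Relation.Binary.Permutation.Setoid.Properties as ↭ₛ
open import Data.List.Relation.Unary.All as All using (All; []; _∷_)
import Data.List.Relation.Unary.All.Properties as All
open import Data.List.Relation.Unary.AllPairs as AllPairs using ([]; _∷_)
open import Data.List.Relation.Unary.Any using (here; there)
open import Data.List.Relation.Unary.Unique.Propositional using (Unique)
open import Data.List.Relation.Unary.Unique.Propositional.Properties as Unique using (Unique[x∷xs]⇒x∉xs)
open import Data.Nat using (ℕ; zero; suc; _+_; _*_; _∸_; _≤_; _<_; _<ᵇ_; z≤n; s≤s; _<?_)
open import Data.Nat.Induction using (<-wellFounded)
open import Data.Nat.ListAction using (sum)
open import Data.Nat.ListAction.Properties using (sum-↭)
open import Data.Nat.Properties hiding (_≟_)
open import Data.Nat.Tactic.RingSolver using (solve-∀)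
open import Data.Product using (Σ; ∃; _×_; _,_; proj₁; proj₂)
open import Data.Sum using (_⊎_; inj₁; inj₂)
open import Data.Vec.Base using () renaming (_∷_ to _∷ᵥ_; there to thereᵥ)
open import Function using (_∘_; id)
open import Function.Bundles using (mk⇔; module Equivalence)
open import Induction.WellFounded using (Acc; acc)
open import Relation.Binary.PropositionalEquality using (_≡_; _≢_; refl; sym; trans; cong; cong₂; subst; subst₂; setoid; ≢-sym; module ≡-Reasoning)
open import Relation.Nullary using (¬_; Dec; does; yes; no; contradiction)
open import Relation.Nullary.Decidable using (_×-dec_; ¬?)

-- Call an element minimal if its singleton is feasible. In a basic word a minimal element may
-- always be moved one step earlier and, since the height is at most two, a non-minimal one may
-- always be moved one step later; so, reversing words if necessary, at least half of the K elements
-- are movable towards the front. Suppose no two of these m = r + 2 ≥ 2 elements are balanced. Then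
-- "x precedes y with probability > 2/3" orders them linearly; let a, b be the last two and let π be
-- the number of elements other than b that precede a. Given everything but the position of b, that
-- position is uniform on an initial segment, whence Pr[b < a] ≥ E[π + 1] / K. In the same way π is
-- a mixture of uniform distributions on initial segments, while E[max (0, r − π)] ≤ r / 3 because
-- each of the r other elements follows a with probability < 1/3; this makes E[π] so large that
-- Pr[b < a] ≥ 1/3, except when m = 2 and K = 4, which is done by hand.

private
  variable
    A B : Set

-- Permutations and distinctness in lists.

Unique-resp-↭ : {xs ys : List A} → xs ↭ ys → Unique xs → Unique ys
Unique-resp-↭ p = ↭ₛ.Unique-resp-↭ (setoid _) (↭⇒↭ₛ p)

∈⇒↭∷ : {x : A} {xs : List A} → x ∈ xs → ∃ λ ys → xs ↭ x ∷ ys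
∈⇒↭∷ x∈xs with ∈-∃++ x∈xs
... | us , vs , refl = us ++ vs , shift _ us vs

-- Sums over finite lists

∑ : (A → ℕ) → List A → ℕ
∑ f xs = sum (map f xs)

∑-↭ : (f : A → ℕ) {xs ys : List A} → xs ↭ ys → ∑ f xs ≡ ∑ f ys
∑-↭ f p = sum-↭ (map⁺ f p)

∑-mono : {f g : A → ℕ} (xs : List A) → (∀ {x} → x ∈ xs → f x ≤ g x) → ∑ f xs ≤ ∑ g xs
∑-mono []       f≤g = z≤n
∑-mono (x ∷ xs) f≤g = +-mono-≤ (f≤g (here refl)) (∑-mono xs (f≤g ∘ there))

∑-cong : {f g : A → ℕ} (xs : List A) → (∀ {x} → x ∈ xs → f x ≡ g x) → ∑ f xs ≡ ∑ g xs
∑-cong []       f≡g = refl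
∑-cong (x ∷ xs) f≡g = cong₂ _+_ (f≡g (here refl)) (∑-cong xs (f≡g ∘ there))

interchange : ∀ a b c d → (a + b) + (c + d) ≡ (a + c) + (b + d)
interchange = solve-∀

∑-+ : (f g : A → ℕ) (xs : List A) → ∑ (λ x → f x + g x) xs ≡ ∑ f xs + ∑ g xs
∑-+ f g []       = refl
∑-+ f g (x ∷ xs) = trans (cong (f x + g x +_) (∑-+ f g xs)) (interchange (f x) (g x) _ _)

∑-* : ∀ c (f : A → ℕ) (xs : List A) → ∑ (λ x → c * f x) xs ≡ c * ∑ f xs
∑-* c f []       = sym (*-zeroʳ c)
∑-* c f (x ∷ xs) = trans (cong (c * f x +_) (∑-* c f xs)) (sym (*-distribˡ-+ c (f x) _))

∑-const : ∀ c (xs : List A) → ∑ (λ _ → c) xs ≡ length xs * c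
∑-const c []       = refl
∑-const c (x ∷ xs) = cong (c +_) (∑-const c xs)

∑-length : (xs : List A) → ∑ (λ _ → 1) xs ≡ length xs
∑-length xs = trans (∑-const 1 xs) (*-identityʳ _)

∑-comm : (f : A → B → ℕ) (xs : List A) (ys : List B) →
         ∑ (λ x → ∑ (f x) ys) xs ≡ ∑ (λ y → ∑ (λ x → f x y) xs) ys
∑-comm f []       ys = sym (trans (∑-const 0 ys) (*-zeroʳ (length ys)))
∑-comm f (x ∷ xs) ys = trans (cong (∑ (f x) ys +_) (∑-comm f xs ys)) (sym (∑-+ (f x) _ ys))

-- ρ is a left inverse of the map x ↦ y, which is therefore injective.
∑-injection : (f g : A → ℕ) (ρ : A → A) (xs ys : List A) → Unique xs →
              (∀ {x} → x ∈ xs → f x ≡ 0 ⊎ ∃ λ y → y ∈ ys × ρ y ≡ x × f x ≤ g y) →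
              ∑ f xs ≤ ∑ g ys
∑-injection f g ρ []       ys _ _ = z≤n
∑-injection f g ρ (x ∷ xs) ys u@(_ ∷ uxs) h with h (here refl)
... | inj₁ fx≡0 = subst (λ k → k + ∑ f xs ≤ ∑ g ys) (sym fx≡0)
                    (∑-injection f g ρ xs ys uxs (h ∘ there))
... | inj₂ (y , y∈ys , ρy≡x , fx≤gy) with ∈⇒↭∷ y∈ys
...   | zs , ys↭ = subst (_ ≤_) (sym (∑-↭ g ys↭))
                     (+-mono-≤ fx≤gy (∑-injection f g ρ xs zs uxs h′))
  where
  h′ : ∀ {x′} → x′ ∈ xs → f x′ ≡ 0 ⊎ ∃ λ y′ → y′ ∈ zs × ρ y′ ≡ x′ × f x′ ≤ g y′
  h′ x′∈xs with h (there x′∈xs)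
  ... | inj₁ e = inj₁ e
  ... | inj₂ (y′ , y′∈ys , ρy′≡x′ , le) with ∈-resp-↭ ys↭ y′∈ys
  ...   | there y′∈zs = inj₂ (y′ , y′∈zs , ρy′≡x′ , le)
  ...   | here refl   = contradiction (subst (_∈ xs) (trans (sym ρy′≡x′) ρy≡x) x′∈xs)
                                      (Unique[x∷xs]⇒x∉xs u)

-- Summation by parts

-- The bound is exclusive, so the sum over the initial segment ending at a value `t` is
-- `cumul f (suc t)`.
cumul : (ℕ → ℕ) → ℕ → ℕ
cumul f zero    = 0
cumul f (suc t) = cumul f t + f t

-- The hypothesis `lower` says that inside each class of constant c the number of elements with
-- τ = t is nonincreasing in t.
module Abel (ws : List A) (uws : Unique ws) (τ c : A → ℕ) (ρ : A → A)
  (lower : ∀ {w} → w ∈ ws →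
           τ w ≡ 0 ⊎ ∃ λ w′ → w′ ∈ ws × ρ w′ ≡ w × suc (τ w′) ≡ τ w × c w′ ≡ c w) where

  -- With `D` the gap between the cumulated sums, the right side exceeds the left by the sum of `D`
  -- at `suc (τ w)` minus the sum of `D` at `τ w`. Since `lower` matches each element at a positive
  -- level injectively with one a level below, this difference is nonnegative.
  ∑-by-parts : (φ ψ : ℕ → ℕ → ℕ) →
    (∀ {w} → w ∈ ws → cumul (φ (c w)) (suc (τ w)) ≤ cumul (ψ (c w)) (suc (τ w))) →
    ∑ (λ w → φ (c w) (τ w)) ws ≤ ∑ (λ w → ψ (c w) (τ w)) ws
  ∑-by-parts φ ψ Φ≤Ψ = +-cancelʳ-≤ (∑ (λ w → D (c w) (suc (τ w))) ws) _ _ (begin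
      ∑ (λ w → φ (c w) (τ w)) ws + ∑ (λ w → D (c w) (suc (τ w))) ws
        ≡⟨ ∑-+ _ _ ws ⟨
      ∑ (λ w → φ (c w) (τ w) + D (c w) (suc (τ w))) ws
        ≡⟨ ∑-cong ws (λ w∈ → step _ _ (Φ≤Ψ′ w∈) (Φ≤Ψ w∈)) ⟩
      ∑ (λ w → ψ (c w) (τ w) + D (c w) (τ w)) ws
        ≡⟨ ∑-+ _ _ ws ⟩
      ∑ (λ w → ψ (c w) (τ w)) ws + ∑ (λ w → D (c w) (τ w)) ws
        ≤⟨ +-monoʳ-≤ _ (∑-injection _ _ ρ ws ws uws shiftD) ⟩
      ∑ (λ w → ψ (c w) (τ w)) ws + ∑ (λ w → D (c w) (suc (τ w))) ws ∎)
    where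
    open ≤-Reasoning

    D : ℕ → ℕ → ℕ
    D d t = cumul (ψ d) t ∸ cumul (φ d) t

    -- The hypothesis speaks of `suc (τ w)`; at `τ w` the inequality is that of the element one
    -- level below. Together they make the truncated differences in `D` exact.
    Φ≤Ψ′ : ∀ {w} → w ∈ ws → cumul (φ (c w)) (τ w) ≤ cumul (ψ (c w)) (τ w)
    Φ≤Ψ′ w∈ with lower w∈
    ... | inj₁ τ≡0 rewrite τ≡0 = z≤n
    ... | inj₂ (w′ , w′∈ , _ , τ≡ , c≡) rewrite sym τ≡ | sym c≡ = Φ≤Ψ w′∈

    step : ∀ d t → cumul (φ d) t ≤ cumul (ψ d) t → cumul (φ d) (suc t) ≤ cumul (ψ d) (suc t) →
           φ d t + D d (suc t) ≡ ψ d t + D d t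
    step d t le le′ = +-cancelʳ-≡ (cumul (φ d) t) _ _ (begin-equality
      (φ d t + D d (suc t)) + cumul (φ d) t  ≡⟨ rearrange (φ d t) (D d (suc t)) _ ⟩
      D d (suc t) + cumul (φ d) (suc t)      ≡⟨ m∸n+n≡m le′ ⟩
      cumul (ψ d) t + ψ d t                  ≡⟨ +-comm _ (ψ d t) ⟩
      ψ d t + cumul (ψ d) t                  ≡⟨ cong (ψ d t +_) (m∸n+n≡m le) ⟨
      ψ d t + (D d t + cumul (φ d) t)        ≡⟨ +-assoc (ψ d t) _ _ ⟨
      (ψ d t + D d t) + cumul (φ d) t        ∎)
      where
      rearrange : ∀ p q s → (p + q) + s ≡ q + (s + p)
      rearrange = solve-∀

    shiftD : ∀ {w} → w ∈ ws →
      D (c w) (τ w) ≡ 0 ⊎ ∃ λ w′ → w′ ∈ ws × ρ w′ ≡ w × D (c w) (τ w) ≤ D (c w′) (suc (τ w′))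
    shiftD w∈ with lower w∈
    ... | inj₁ τ≡0 rewrite τ≡0 = inj₁ refl
    ... | inj₂ (w′ , w′∈ , ρ≡ , τ≡ , c≡) =
      inj₂ (w′ , w′∈ , ρ≡ , ≤-reflexive (sym (cong₂ D c≡ τ≡)))

-- Positions in words

ind : Bool → ℕ
ind true  = 1
ind false = 0

ind≤1 : ∀ c → ind c ≤ 1
ind≤1 true  = ≤-refl
ind≤1 false = z≤n

module _ {n : ℕ} where

  private
    Letter = Fin n
    Word = List Letter

  precedes-head : (x y : Letter) (w : Word) → precedes x y (x ∷ w) ≡ true
  precedes-head x y w with x ≟ x
  ... | yes _  = refl
  ... | no x≢x = contradiction refl x≢x

  precedes-head′ : {x y : Letter} (w : Word) → x ≢ y → precedes x y (y ∷ w) ≡ false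
  precedes-head′ {x} {y} w x≢y with y ≟ x | y ≟ y
  ... | yes y≡x | _      = contradiction (sym y≡x) x≢y
  ... | no _    | yes _  = refl
  ... | no _    | no y≢y = contradiction refl y≢y

  precedes-tail : {x y z : Letter} (w : Word) → z ≢ x → z ≢ y → precedes x y (z ∷ w) ≡ precedes x y w
  precedes-tail {x} {y} {z} w z≢x z≢y with z ≟ x | z ≟ y
  ... | yes z≡x | _       = contradiction z≡x z≢x
  ... | no _    | yes z≡y = contradiction z≡y z≢y
  ... | no _    | no _    = refl

  countBefore≡∑ : (x y : Letter) (ws : List Word) → countBefore x y ws ≡ ∑ (ind ∘ precedes x y) ws
  countBefore≡∑ x y []       = refl
  countBefore≡∑ x y (w ∷ ws) with precedes x y w
  ... | true  = cong suc (countBefore≡∑ x y ws)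
  ... | false = countBefore≡∑ x y ws

  precedes-total : {x y : Letter} (w : Word) → x ≢ y → x ∈ w →
                   ind (precedes x y w) + ind (precedes y x w) ≡ 1
  precedes-total {x} {y} (z ∷ w) x≢y x∈ with z ≟ x | z ≟ y
  ... | yes refl | yes refl = contradiction refl x≢y
  ... | yes _    | no _     = refl
  ... | no _     | yes _    = refl
  precedes-total (z ∷ w) x≢y (here x≡z)  | no z≢x | no _ = contradiction (sym x≡z) z≢x
  precedes-total (z ∷ w) x≢y (there x∈w) | no _   | no _ = precedes-total w x≢y x∈w

  -- If z stands before x, then y stands before x or z before y. Summed over all words, this is what
  -- makes `≺` transitive.
  precedes-triangle : {x y z : Letter} (w : Word) → x ≢ z →
    ind (precedes z x w) ≤ ind (precedes y x w) + ind (precedes z y w)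
  precedes-triangle [] _ = z≤n
  precedes-triangle {x} {y} {z} (h ∷ w) x≢z with h ≟ z | h ≟ x | h ≟ y
  ... | yes refl | yes refl | _     = contradiction refl x≢z
  ... | yes _    | no _     | yes _ = s≤s z≤n
  ... | yes _    | no _     | no _  = m≤n+m 1 _
  ... | no _     | yes _    | _     = z≤n
  ... | no _     | no _     | yes _ = ≤-trans (ind≤1 _) (s≤s z≤n)
  ... | no _     | no _     | no _  = precedes-triangle w x≢z

  index : Letter → Word → ℕ
  index x []      = 0
  index x (z ∷ w) with z ≟ x
  ... | yes _ = 0
  ... | no _  = suc (index x w)

  -- The π of the overview: the position of `a` once `b` is deleted, hence insensitive to moves of
  -- `b`.
  indexWithout : Letter → Letter → Word → ℕ
  indexWithout b a []      = 0
  indexWithout b a (z ∷ w) with z ≟ a | z ≟ b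
  ... | yes _ | _     = 0
  ... | no _  | yes _ = indexWithout b a w
  ... | no _  | no _  = suc (indexWithout b a w)

  index<length : {x : Letter} {w : Word} → x ∈ w → index x w < length w
  index<length {x} {z ∷ w} x∈ with z ≟ x
  ... | yes _ = s≤s z≤n
  index<length {x} {z ∷ w} (here x≡z) | no z≢x = contradiction (sym x≡z) z≢x
  index<length {x} {z ∷ w} (there x∈) | no _   = s≤s (index<length x∈)

  indexWithout<length : {b a : Letter} {w : Word} → a ∈ w → indexWithout b a w < length w
  indexWithout<length {b} {a} {z ∷ w} a∈ with z ≟ a | z ≟ b
  ... | yes _ | _ = s≤s z≤n
  indexWithout<length (here a≡z) | no z≢a | _     = contradiction (sym a≡z) z≢a
  indexWithout<length (there a∈) | no _   | yes _ = m≤n⇒m≤1+n (indexWithout<length a∈)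
  indexWithout<length (there a∈) | no _   | no _  = s≤s (indexWithout<length a∈)

  -- Deleting `b` leaves π letters in front of `a`, so `b` comes first exactly when its own position
  -- is at most π. For fixed π, precedence thus becomes a threshold on the position of `b`.
  precedes≡index< : {a b : Letter} (w : Word) → a ≢ b → b ∈ w →
                    precedes b a w ≡ (index b w <ᵇ suc (indexWithout b a w))
  precedes≡index< {a} {b} (z ∷ w) a≢b b∈ with z ≟ a | z ≟ b
  ... | yes refl | yes refl = contradiction refl a≢b
  ... | yes _    | no _     = refl
  ... | no _     | yes _    = refl
  precedes≡index< (z ∷ w) a≢b (here b≡z) | no _ | no z≢b = contradiction (sym b≡z) z≢b
  precedes≡index< (z ∷ w) a≢b (there b∈) | no _ | no _   = precedes≡index< w a≢b b∈

  occurrences : Letter → Word → ℕ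
  occurrences z = ∑ (λ x → ind (does (z ≟ x)))

  occurrences-∉ : {z : Letter} (xs : Word) → z ∉ xs → occurrences z xs ≡ 0
  occurrences-∉ []       _ = refl
  occurrences-∉ {z} (x ∷ xs) z∉ with z ≟ x
  ... | yes z≡x = contradiction (here z≡x) z∉
  ... | no _    = occurrences-∉ xs (z∉ ∘ there)

  occurrences≤1 : {z : Letter} {xs : Word} → Unique xs → occurrences z xs ≤ 1
  occurrences≤1 {xs = []} _ = z≤n
  occurrences≤1 {z} {x ∷ xs} u@(_ ∷ uxs) with z ≟ x
  ... | yes refl = ≤-reflexive (cong suc (occurrences-∉ xs (Unique[x∷xs]⇒x∉xs u)))
  ... | no _     = occurrences≤1 {z = z} uxs

  indexWithout-head : (b a : Letter) (w : Word) → indexWithout b a (a ∷ w) ≡ 0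
  indexWithout-head b a w with a ≟ a
  ... | yes _  = refl
  ... | no a≢a = contradiction refl a≢a

  indexWithout-skip : {b a : Letter} (w : Word) → b ≢ a → indexWithout b a (b ∷ w) ≡ indexWithout b a w
  indexWithout-skip {b} {a} w b≢a with b ≟ a | b ≟ b
  ... | yes b≡a | _      = contradiction b≡a b≢a
  ... | no _    | yes _  = refl
  ... | no _    | no b≢b = contradiction refl b≢b

  indexWithout-tail : {b a z : Letter} (w : Word) → z ≢ a → z ≢ b →
                      indexWithout b a (z ∷ w) ≡ suc (indexWithout b a w)
  indexWithout-tail {b} {a} {z} w z≢a z≢b with z ≟ a | z ≟ b
  ... | yes z≡a | _       = contradiction z≡a z≢a
  ... | no _    | yes z≡b = contradiction z≡b z≢b
  ... | no _    | no _    = refl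

  -- The letters of xs that precede a are distinct and different from b.
  length≤after+indexWithout : {a b : Letter} {xs : Word} (w : Word) →
    Unique xs → b ≢ a → b ∉ xs → a ∈ w →
    length xs ≤ ∑ (λ x → ind (precedes a x w)) xs + indexWithout b a w
  length≤after+indexWithout {a} {b} {xs} (z ∷ w) u b≢a b∉ a∈ = helper (z ≟ a) (z ≟ b) a∈
    where
    open ≤-Reasoning

    i = indexWithout b a w

    after : Word → ℕ
    after w = ∑ (λ x → ind (precedes a x w)) xs

    -- Putting `z` in front can spoil the count only for an `x` equal to `z`; this loss of at most
    -- one is made up by the increase of `indexWithout`.
    pointwise : z ≢ a → ∀ x → ind (precedes a x w) ≤ ind (precedes a x (z ∷ w)) + ind (does (z ≟ x))
    pointwise z≢a x with z ≟ a | z ≟ x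
    ... | yes z≡a | _     = contradiction z≡a z≢a
    ... | no _    | yes _ = ind≤1 _
    ... | no _    | no _  = m≤m+n _ 0

    helper : Dec (z ≡ a) → Dec (z ≡ b) → a ∈ z ∷ w → length xs ≤ after (z ∷ w) + indexWithout b a (z ∷ w)
    helper (yes refl) _ _ = begin
      length xs     ≡⟨ ∑-length xs ⟨
      ∑ (λ _ → 1) xs ≡⟨ ∑-cong xs (λ {x} _ → cong ind (precedes-head z x w)) ⟨
      after (z ∷ w) ≤⟨ m≤m+n _ _ ⟩
      after (z ∷ w) + indexWithout b a (z ∷ w) ∎
    helper (no z≢a) _ (here a≡z) = contradiction (sym a≡z) z≢a
    helper (no z≢a) (yes refl) (there a∈) = begin
      length xs         ≤⟨ length≤after+indexWithout w u b≢a b∉ a∈ ⟩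
      after w + i
        ≡⟨ cong₂ _+_ (∑-cong xs (λ x∈ → cong ind (precedes-tail w z≢a (λ { refl → b∉ x∈ }))))
                     (indexWithout-skip w b≢a) ⟨
      after (z ∷ w) + indexWithout b a (z ∷ w) ∎
    helper (no z≢a) (no z≢b) (there a∈) = begin
      length xs
        ≤⟨ length≤after+indexWithout w u b≢a b∉ a∈ ⟩
      after w + i
        ≤⟨ +-monoˡ-≤ i (∑-mono xs (λ {x} _ → pointwise z≢a x)) ⟩
      ∑ (λ x → ind (precedes a x (z ∷ w)) + ind (does (z ≟ x))) xs + i
        ≡⟨ cong (_+ i) (∑-+ _ _ xs) ⟩
      (after (z ∷ w) + occurrences z xs) + i
        ≤⟨ +-monoˡ-≤ i (+-monoʳ-≤ _ (occurrences≤1 {z = z} u)) ⟩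
      (after (z ∷ w) + 1) + i
        ≡⟨ +-assoc (after (z ∷ w)) 1 i ⟩
      after (z ∷ w) + suc i
        ≡⟨ cong (after (z ∷ w) +_) (indexWithout-tail w z≢a z≢b) ⟨
      after (z ∷ w) + indexWithout b a (z ∷ w) ∎

-- Splitting words and moving single letters.

Unique-++∷⇒∉ : {A : Set} {x : A} (u : List A) {v : List A} → Unique (u ++ x ∷ v) → x ∉ u
Unique-++∷⇒∉ u {v} uw = Unique[x∷xs]⇒x∉xs (Unique-resp-↭ (shift _ u v) uw) ∘ ∈-++⁺ˡ

module _ {n : ℕ} where

  private
    Letter = Fin n
    Word = List Letter

  index-++ : {x : Letter} (u : Word) {v : Word} → x ∉ u → index x (u ++ x ∷ v) ≡ length u
  index-++ {x} [] _ with x ≟ x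
  ... | yes _  = refl
  ... | no x≢x = contradiction refl x≢x
  index-++ {x} (y ∷ u) x∉ with y ≟ x
  ... | yes y≡x = contradiction (here (sym y≡x)) x∉
  ... | no _    = cong suc (index-++ u (x∉ ∘ there))

  -- The term at `u ++ [ a ]` counts the letters of `u` other than `b`, since `a` itself stops the
  -- count.
  indexWithout-++ : {b a : Letter} (u v : Word) → a ∉ u →
    indexWithout b a (u ++ v) ≡ indexWithout b a (u ++ [ a ]) + indexWithout b a v
  indexWithout-++ {b} {a} [] v _ = cong (_+ indexWithout b a v) (sym (indexWithout-head b a []))
  indexWithout-++ {b} {a} (y ∷ u) v a∉ with y ≟ a | y ≟ b
  ... | yes y≡a | _     = contradiction (here (sym y≡a)) a∉
  ... | no _    | yes _ = indexWithout-++ u v (a∉ ∘ there)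
  ... | no _    | no _  = cong suc (indexWithout-++ u v (a∉ ∘ there))

  indexWithout-swap : {b a : Letter} → b ≢ a → (u : Word) (z : Letter) (v : Word) →
    indexWithout b a (u ++ b ∷ z ∷ v) ≡ indexWithout b a (u ++ z ∷ b ∷ v)
  indexWithout-swap {b} {a} b≢a (y ∷ u) z v with y ≟ a | y ≟ b
  ... | yes _ | _     = refl
  ... | no _  | yes _ = indexWithout-swap b≢a u z v
  ... | no _  | no _  = cong suc (indexWithout-swap b≢a u z v)
  indexWithout-swap {b} {a} b≢a [] z v = trans (indexWithout-skip (z ∷ v) b≢a) (helper (z ≟ a) (z ≟ b))
    where
    helper : Dec (z ≡ a) → Dec (z ≡ b) → indexWithout b a (z ∷ v) ≡ indexWithout b a (z ∷ b ∷ v)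
    helper (yes refl) _ = trans (indexWithout-head b a v) (sym (indexWithout-head b a (b ∷ v)))
    helper (no z≢a) (yes refl) = sym (indexWithout-skip (b ∷ v) b≢a)
    helper (no z≢a) (no z≢b) = begin
      indexWithout b a (z ∷ v)           ≡⟨ indexWithout-tail v z≢a z≢b ⟩
      suc (indexWithout b a v)           ≡⟨ cong suc (indexWithout-skip v b≢a) ⟨
      suc (indexWithout b a (b ∷ v))     ≡⟨ indexWithout-tail (b ∷ v) z≢a z≢b ⟨
      indexWithout b a (z ∷ b ∷ v)       ∎
      where open ≡-Reasoning

  swapHead : Word → Word
  swapHead (y ∷ z ∷ w) = z ∷ y ∷ w
  swapHead w           = w

  -- Undoes a move of `x` by one place towards the front; it is the left inverse `ρ` that shows this
  -- move to be injective.
  later : Letter → Word → Word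
  later x []      = []
  later x (y ∷ w) with y ≟ x
  ... | yes _ = swapHead (y ∷ w)
  ... | no _  = y ∷ later x w

  later-++ : {x : Letter} (u : Word) {z : Letter} {v : Word} → x ∉ u →
             later x (u ++ x ∷ z ∷ v) ≡ u ++ z ∷ x ∷ v
  later-++ {x} [] _ with x ≟ x
  ... | yes _  = refl
  ... | no x≢x = contradiction refl x≢x
  later-++ {x} (y ∷ u) x∉ with y ≟ x
  ... | yes y≡x = contradiction (here (sym y≡x)) x∉
  ... | no _    = cong (y ∷_) (later-++ u (x∉ ∘ there))

  -- The head is exchanged with the next letter other than `b`, while an intervening `b` keeps its
  -- place. This undoes the moves in `move-adjacent` and `move-across`.
  hop : Letter → Word → Word
  hop b (y ∷ z ∷ w) with z ≟ b
  hop b (y ∷ z ∷ [])     | yes _ = y ∷ z ∷ []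
  hop b (y ∷ z ∷ z′ ∷ w) | yes _ = z′ ∷ z ∷ y ∷ w
  hop b (y ∷ z ∷ w)      | no _  = z ∷ y ∷ w
  hop b w = w

  laterWithout : Letter → Letter → Word → Word
  laterWithout b a []      = []
  laterWithout b a (y ∷ w) with y ≟ a
  ... | yes _ = hop b (y ∷ w)
  ... | no _  = y ∷ laterWithout b a w

  laterWithout-++ : {b a : Letter} (u v : Word) → a ∉ u →
                    laterWithout b a (u ++ a ∷ v) ≡ u ++ hop b (a ∷ v)
  laterWithout-++ {b} {a} [] v _ with a ≟ a
  ... | yes _  = refl
  ... | no a≢a = contradiction refl a≢a
  laterWithout-++ {b} {a} (y ∷ u) v a∉ with y ≟ a
  ... | yes y≡a = contradiction (here (sym y≡a)) a∉
  ... | no _    = cong (y ∷_) (laterWithout-++ u v (a∉ ∘ there))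

  hop-adjacent : {b y z : Letter} (w : Word) → z ≢ b → hop b (y ∷ z ∷ w) ≡ z ∷ y ∷ w
  hop-adjacent {b} {y} {z} w z≢b with z ≟ b
  ... | yes z≡b = contradiction z≡b z≢b
  ... | no _ = refl

  hop-across : (b y z : Letter) (w : Word) → hop b (y ∷ b ∷ z ∷ w) ≡ z ∷ b ∷ y ∷ w
  hop-across b y z w with b ≟ b
  ... | yes _  = refl
  ... | no b≢b = contradiction refl b≢b

-- Sums over initial segments of the natural numbers.

2xy≤x²+y² : ∀ x y → 2 * (x * y) ≤ x * x + y * y
2xy≤x²+y² x y with ≤-total x y
... | inj₁ x≤y with m≤n⇒∃[o]m+o≡n x≤y
...   | d , refl = subst (2 * (x * (x + d)) ≤_) (sym (expand x d)) (m≤m+n _ (d * d))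
  where
  expand : ∀ x d → x * x + (x + d) * (x + d) ≡ 2 * (x * (x + d)) + d * d
  expand = solve-∀
2xy≤x²+y² x y | inj₂ y≤x with m≤n⇒∃[o]m+o≡n y≤x
...   | d , refl = subst (2 * ((y + d) * y) ≤_) (sym (expand y d)) (m≤m+n _ (d * d))
  where
  expand : ∀ y d → (y + d) * (y + d) + y * y ≡ 2 * ((y + d) * y) + d * d
  expand = solve-∀

cumul-const : ∀ c t → cumul (λ _ → c) t ≡ t * c
cumul-const c zero    = refl
cumul-const c (suc t) = trans (cong (_+ c) (cumul-const c t)) (+-comm (t * c) c)

-- Closed form of an arithmetic sum, with `t * t` moved to the left so that no subtraction occurs.
cumul-∸ : ∀ r t → t ≤ r → 2 * cumul (r ∸_) t + t * t ≡ t * (2 * r + 1)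
cumul-∸ r zero    _ = refl
cumul-∸ r (suc t) t<r with m≤n⇒∃[o]m+o≡n (<⇒≤ t<r)
... | e , refl = begin
  2 * (cumul (t + e ∸_) t + (t + e ∸ t)) + suc t * suc t
    ≡⟨ cong (λ z → 2 * (cumul (t + e ∸_) t + z) + suc t * suc t) (m+n∸m≡n t e) ⟩
  2 * (cumul (t + e ∸_) t + e) + suc t * suc t
    ≡⟨ expand (cumul (t + e ∸_) t) e t ⟩
  (2 * cumul (t + e ∸_) t + t * t) + (2 * (t + e) + 1)
    ≡⟨ cong (_+ (2 * (t + e) + 1)) (cumul-∸ (t + e) t (m≤m+n t e)) ⟩
  t * (2 * (t + e) + 1) + (2 * (t + e) + 1)
    ≡⟨ +-comm (t * (2 * (t + e) + 1)) _ ⟩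
  suc t * (2 * (t + e) + 1) ∎
  where
  open ≡-Reasoning
  expand : ∀ S e t → 2 * (S + e) + suc t * suc t ≡ (2 * S + t * t) + (2 * (t + e) + 1)
  expand = solve-∀

cumul-∸-const : ∀ r d → cumul (r ∸_) (r + d) ≡ cumul (r ∸_) r
cumul-∸-const r zero    = cong (cumul (r ∸_)) (+-identityʳ r)
cumul-∸-const r (suc d) = begin
  cumul (r ∸_) (r + suc d)                ≡⟨ cong (cumul (r ∸_)) (+-suc r d) ⟩
  cumul (r ∸_) (r + d) + (r ∸ (r + d))    ≡⟨ cong₂ _+_ (cumul-∸-const r d) (m≤n⇒m∸n≡0 (m≤m+n r d)) ⟩
  cumul (r ∸_) r + 0                      ≡⟨ +-identityʳ _ ⟩
  cumul (r ∸_) r                          ∎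
  where open ≡-Reasoning

-- For t ≥ r the difference of the two sides is r (3 (r + 1) − 2 t)².
cumul-∸-bound : ∀ r t → 12 * r * (r + 1) * t ≤ 9 * (r + 1) * (2 * cumul (r ∸_) t) + 4 * r * (t * t)
cumul-∸-bound r t with ≤-total t r
... | inj₁ t≤r with m≤n⇒∃[o]m+o≡n t≤r
...   | e , refl = subst₂ _≤_ refl (cong (λ z → 9 * (t + e + 1) * z + 4 * (t + e) * (t * t)) (sym S≡))
                     (subst (12 * (t + e) * (t + e + 1) * t ≤_) (sym (expand t e)) (m≤m+n _ _))
  where
  S≡ : 2 * cumul (t + e ∸_) t ≡ t * (t + 2 * e + 1)
  S≡ = +-cancelʳ-≡ (t * t) _ _ (trans (cumul-∸ (t + e) t t≤r) (e′ t e))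
    where
    e′ : ∀ t e → t * (2 * (t + e) + 1) ≡ t * (t + 2 * e + 1) + t * t
    e′ = solve-∀
  expand : ∀ t e → 9 * (t + e + 1) * (t * (t + 2 * e + 1)) + 4 * (t + e) * (t * t) ≡
    12 * (t + e) * (t + e + 1) * t + t * (t * t + 7 * t * e + 6 * e * e + 6 * t + 15 * e + 9)
  expand = solve-∀
cumul-∸-bound r t | inj₂ r≤t with m≤n⇒∃[o]m+o≡n r≤t
... | d , refl = begin
  12 * r * (r + 1) * t                               ≡⟨ e₁ r t ⟩
  r * (2 * ((3 * (r + 1)) * (2 * t)))                ≤⟨ *-monoʳ-≤ r (2xy≤x²+y² (3 * (r + 1)) (2 * t)) ⟩
  r * (3 * (r + 1) * (3 * (r + 1)) + 2 * t * (2 * t)) ≡⟨ e₂ r t ⟩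
  9 * (r + 1) * (r * (r + 1)) + 4 * r * (t * t)      ≡⟨ cong (λ z → 9 * (r + 1) * z + 4 * r * (t * t)) S≡ ⟨
  9 * (r + 1) * (2 * cumul (r ∸_) t) + 4 * r * (t * t) ∎
  where
  open ≤-Reasoning
  e₁ : ∀ r t → 12 * r * (r + 1) * t ≡ r * (2 * ((3 * (r + 1)) * (2 * t)))
  e₁ = solve-∀
  e₂ : ∀ r t → r * (3 * (r + 1) * (3 * (r + 1)) + 2 * t * (2 * t)) ≡ 9 * (r + 1) * (r * (r + 1)) + 4 * r * (t * t)
  e₂ = solve-∀
  e₃ : ∀ r → r * (2 * r + 1) ≡ r * (r + 1) + r * r
  e₃ = solve-∀
  S≡ : 2 * cumul (r ∸_) (r + d) ≡ r * (r + 1)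
  S≡ = trans (cong (2 *_) (cumul-∸-const r d))
         (+-cancelʳ-≡ (r * r) _ _ (trans (cumul-∸ r r ≤-refl) (e₃ r)))

-- ψ is a combination of r ∸ t and t whose average over an initial segment is minimal near
-- 2 t = 3 (r + 1).
ψ : ℕ → ℕ → ℕ
ψ r t = 9 * (r + 1) * (r ∸ t) + 4 * r * t

-- Twice the sum of the numbers below `t` is t² - t; the term `4 * r * t` on the left absorbs the
-- subtraction.
cumul-ψ : ∀ r t → 2 * cumul (ψ r) t + 4 * r * t ≡ 9 * (r + 1) * (2 * cumul (r ∸_) t) + 4 * r * (t * t)
cumul-ψ r zero = e r
  where
  e : ∀ r → 4 * r * 0 ≡ 9 * (r + 1) * 0 + 4 * r * 0
  e = solve-∀
cumul-ψ r (suc t) = begin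
  2 * (cumul (ψ r) t + ψ r t) + 4 * r * suc t
    ≡⟨ e₁ (cumul (ψ r) t) (r ∸ t) r t ⟩
  (2 * cumul (ψ r) t + 4 * r * t) + (2 * (9 * (r + 1) * (r ∸ t)) + 4 * r * (2 * t + 1))
    ≡⟨ cong (_+ (2 * (9 * (r + 1) * (r ∸ t)) + 4 * r * (2 * t + 1))) (cumul-ψ r t) ⟩
  9 * (r + 1) * (2 * cumul (r ∸_) t) + 4 * r * (t * t) + (2 * (9 * (r + 1) * (r ∸ t)) + 4 * r * (2 * t + 1))
    ≡⟨ e₂ (cumul (r ∸_) t) (r ∸ t) r t ⟩
  9 * (r + 1) * (2 * (cumul (r ∸_) t + (r ∸ t))) + 4 * r * (suc t * suc t) ∎
  where
  open ≡-Reasoning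
  e₁ : ∀ C s r t → 2 * (C + (9 * (r + 1) * s + 4 * r * t)) + 4 * r * suc t ≡
       (2 * C + 4 * r * t) + (2 * (9 * (r + 1) * s) + 4 * r * (2 * t + 1))
  e₁ = solve-∀
  e₂ : ∀ S s r t → 9 * (r + 1) * (2 * S) + 4 * r * (t * t) + (2 * (9 * (r + 1) * s) + 4 * r * (2 * t + 1)) ≡
       9 * (r + 1) * (2 * (S + s)) + 4 * r * (suc t * suc t)
  e₂ = solve-∀

-- This is `6 * r * (r + 1)`, obtained from `cumul-∸-bound`, less the `2 * r` due to the extra term
-- in `cumul-ψ`. It bounds the average of `ψ r` over every initial segment from below.
φ : ℕ → ℕ
φ r = 6 * r * r + 4 * r

φ≤cumul-ψ : ∀ r t → cumul (λ _ → φ r) t ≤ cumul (ψ r) t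
φ≤cumul-ψ r t = *-cancelˡ-≤ 2 (+-cancelʳ-≤ (4 * r * t) _ _ (begin
  2 * cumul (λ _ → φ r) t + 4 * r * t  ≡⟨ cong (λ z → 2 * z + 4 * r * t) (cumul-const (φ r) t) ⟩
  2 * (t * φ r) + 4 * r * t            ≡⟨ e r t ⟩
  12 * r * (r + 1) * t                 ≤⟨ cumul-∸-bound r t ⟩
  9 * (r + 1) * (2 * cumul (r ∸_) t) + 4 * r * (t * t) ≡⟨ cumul-ψ r t ⟨
  2 * cumul (ψ r) t + 4 * r * t        ∎))
  where
  open ≤-Reasoning
  e : ∀ r t → 2 * (t * (6 * r * r + 4 * r)) + 4 * r * t ≡ 12 * r * (r + 1) * t
  e = solve-∀

<⇒<ᵇ≡true : ∀ {m n} → m < n → (m <ᵇ n) ≡ true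
<⇒<ᵇ≡true {zero}  (s≤s _)   = refl
<⇒<ᵇ≡true {suc m} (s≤s m<n) = <⇒<ᵇ≡true m<n

cumul-mono : (f : ℕ → ℕ) {s t : ℕ} → s ≤ t → cumul f s ≤ cumul f t
cumul-mono f {zero}  {t}     _ = z≤n
cumul-mono f {suc s} {suc t} s<t with m≤n⇒m<n∨m≡n s<t
... | inj₁ (s≤s s<t′) = ≤-trans (cumul-mono f s<t′) (m≤m+n _ (f t))
... | inj₂ refl       = ≤-refl

cumul-below-threshold : ∀ K p t → t ≤ p → cumul (λ s → K * ind (s <ᵇ p)) t ≡ t * K
cumul-below-threshold K p zero    _   = refl
cumul-below-threshold K p (suc t) t<p
  rewrite <⇒<ᵇ≡true t<p | cumul-below-threshold K p t (<⇒≤ t<p) | *-identityʳ K = +-comm (t * K) K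

-- The sum is K times the smaller of `t` and `p`, and the larger of them is at most K.
cumul-threshold : ∀ K p t → p ≤ K → t ≤ K → t * p ≤ cumul (λ s → K * ind (s <ᵇ p)) t
cumul-threshold K p t p≤K t≤K with ≤-total t p
... | inj₁ t≤p = begin
  t * p     ≤⟨ *-monoʳ-≤ t p≤K ⟩
  t * K     ≡⟨ cumul-below-threshold K p t t≤p ⟨
  cumul _ t ∎
  where
  open ≤-Reasoning
... | inj₂ p≤t = begin
  t * p     ≤⟨ *-monoˡ-≤ p t≤K ⟩
  K * p     ≡⟨ *-comm K p ⟩
  p * K     ≡⟨ cumul-below-threshold K p p ≤-refl ⟨
  cumul _ p ≤⟨ cumul-mono _ p≤t ⟩
  cumul _ t ∎
  where
  open ≤-Reasoning

-- Here `n` counts the words, `v` those with b before a, and `S` and `B` are the sums of r ∸ π and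
-- of π. For K ≤ 3 the first two hypotheses suffice. Otherwise, eliminating `S`, `B` and `v` leaves
-- r (r - 1) n + 8 r² + 16 r ≤ 0. The last two terms come from reading `3 * v < n` as 3 v + 1 ≤ n;
-- they decide the case r = 1, whereas for r = 0 everything vanishes.
unbalanced-absurd : ∀ n K v r S B → n + B ≤ K * v → 3 * v < n →
  3 * S ≤ r * n → n * φ r ≤ 9 * (r + 1) * S + 4 * r * B → K ≤ 3 ⊎ (1 ≤ r × K ≤ 2 * r + 4) → ⊥
unbalanced-absurd n K v r S B h₁ h₂ h₃ h₄ (inj₁ K≤3) =
  <-irrefl refl (begin-strict
    n ≤⟨ m≤m+n n B ⟩ n + B ≤⟨ h₁ ⟩ K * v ≤⟨ *-monoˡ-≤ v K≤3 ⟩ 3 * v <⟨ h₂ ⟩ n ∎)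
  where open ≤-Reasoning
unbalanced-absurd n K v r@(suc s) S B h₁ h₂ h₃ h₄ (inj₂ (_ , K≤)) =
  <-irrefl refl (begin-strict
    17 * (r * r * n) + 25 * (r * n)
      <⟨ m<m+n _ (s≤s z≤n) ⟩
    17 * (r * r * n) + 25 * (r * n) + (16 * r + 8 * r * r + s * r * n)
      ≡⟨ e₁ s n ⟩
    3 * (n * φ r) + 12 * (r * n) + 4 * r * (2 * r + 4)
      ≤⟨ +-monoˡ-≤ (4 * r * (2 * r + 4)) (+-monoˡ-≤ (12 * (r * n)) (*-monoʳ-≤ 3 h₄)) ⟩
    3 * (9 * (r + 1) * S + 4 * r * B) + 12 * (r * n) + 4 * r * (2 * r + 4)
      ≡⟨ e₂ r S B n ⟩
    9 * (r + 1) * (3 * S) + 4 * r * (3 * (n + B) + (2 * r + 4))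
      ≤⟨ +-mono-≤ (*-monoʳ-≤ (9 * (r + 1)) h₃) (*-monoʳ-≤ (4 * r) bound) ⟩
    9 * (r + 1) * (r * n) + 4 * r * ((2 * r + 4) * n)
      ≡⟨ e₃ r n ⟩
    17 * (r * r * n) + 25 * (r * n) ∎)
  where
  open ≤-Reasoning
  e₁ : ∀ s n → 17 * (suc s * suc s * n) + 25 * (suc s * n) + (16 * suc s + 8 * suc s * suc s + s * suc s * n) ≡
       3 * (n * (6 * suc s * suc s + 4 * suc s)) + 12 * (suc s * n) + 4 * suc s * (2 * suc s + 4)
  e₁ = solve-∀
  e₂ : ∀ r S B n → 3 * (9 * (r + 1) * S + 4 * r * B) + 12 * (r * n) + 4 * r * (2 * r + 4) ≡
       9 * (r + 1) * (3 * S) + 4 * r * (3 * (n + B) + (2 * r + 4))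
  e₂ = solve-∀
  e₃ : ∀ r n → 9 * (r + 1) * (r * n) + 4 * r * ((2 * r + 4) * n) ≡ 17 * (r * r * n) + 25 * (r * n)
  e₃ = solve-∀
  e₄ : ∀ r v → 3 * ((2 * r + 4) * v) + (2 * r + 4) ≡ (2 * r + 4) * suc (3 * v)
  e₄ = solve-∀
  bound : 3 * (n + B) + (2 * r + 4) ≤ (2 * r + 4) * n
  bound = begin
    3 * (n + B) + (2 * r + 4)          ≤⟨ +-monoˡ-≤ _ (*-monoʳ-≤ 3 (≤-trans h₁ (*-monoˡ-≤ v K≤))) ⟩
    3 * ((2 * r + 4) * v) + (2 * r + 4) ≡⟨ e₄ r v ⟩
    (2 * r + 4) * suc (3 * v)          ≤⟨ *-monoʳ-≤ (2 * r + 4) h₂ ⟩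
    (2 * r + 4) * n                    ∎

-- Movable letters

module Movable {n : ℕ} (ws : List (List (Fin n))) (uws : Unique ws)
  (K : ℕ) (len : ∀ {w} → w ∈ ws → length w ≡ K) (uw : ∀ {w} → w ∈ ws → Unique w) where

  private
    Letter = Fin n
    Word = List Letter

  N : ℕ
  N = length ws

  Present : Letter → Set
  Present x = ∀ {w} → w ∈ ws → x ∈ w

  Movable : Letter → Set
  Movable x = Present x × (∀ u z v → (u ++ z ∷ x ∷ v) ∈ ws → (u ++ x ∷ z ∷ v) ∈ ws)

  Balanced : Letter → Letter → Set
  Balanced x y = N ≤ 3 * countBefore x y ws × 3 * countBefore x y ws ≤ 2 * N

  MovableBalancedPair : Set
  MovableBalancedPair = ∃ λ x → ∃ λ y → Movable x × Movable y × x ≢ y × Balanced x y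

  -- For distinct present letters: the probability that `x` precedes `y` exceeds 2/3.
  _≺_ : Letter → Letter → Set
  x ≺ y = 3 * countBefore y x ws < N

  countBefore-total : ∀ {x y} → Present x → x ≢ y → countBefore x y ws + countBefore y x ws ≡ N
  countBefore-total {x} {y} x∈ x≢y = begin
    countBefore x y ws + countBefore y x ws
      ≡⟨ cong₂ _+_ (countBefore≡∑ x y ws) (countBefore≡∑ y x ws) ⟩
    ∑ (ind ∘ precedes x y) ws + ∑ (ind ∘ precedes y x) ws
      ≡⟨ ∑-+ _ _ ws ⟨
    ∑ (λ w → ind (precedes x y w) + ind (precedes y x w)) ws
      ≡⟨ ∑-cong ws (λ {w} w∈ → precedes-total w x≢y (x∈ w∈)) ⟩
    ∑ (λ _ → 1) ws
      ≡⟨ ∑-length ws ⟩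
    N ∎
    where open ≡-Reasoning

  compare : ∀ {x y} → Present x → x ≢ y → Balanced x y ⊎ (x ≺ y ⊎ y ≺ x)
  compare {x} {y} x∈ x≢y with 3 * countBefore y x ws <? N | 3 * countBefore x y ws <? N
  ... | yes x≺y | _       = inj₂ (inj₁ x≺y)
  ... | no _    | yes y≺x = inj₂ (inj₂ y≺x)
  ... | no x⊀y  | no y⊀x  = inj₁ (≮⇒≥ y⊀x ,
      +-cancelʳ-≤ N _ _ (begin
        3 * cxy + N        ≤⟨ +-monoʳ-≤ (3 * cxy) (≮⇒≥ x⊀y) ⟩
        3 * cxy + 3 * cyx  ≡⟨ *-distribˡ-+ 3 cxy cyx ⟨
        3 * (cxy + cyx)    ≡⟨ cong (3 *_) (countBefore-total x∈ x≢y) ⟩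
        3 * N              ≡⟨ +-comm N (2 * N) ⟩
        2 * N + N          ∎))
    where
    open ≤-Reasoning
    cxy = countBefore x y ws
    cyx = countBefore y x ws

  -- If instead z ≺ x, there is a cycle, and the counts of x before z, y before x and z before y are
  -- each below N / 3. Yet every word satisfies at least one of the three, so they add up to at
  -- least N.
  ≺-trans : ∀ {x y z} → Present x → x ≢ z → x ≺ y → y ≺ z → Balanced x z ⊎ x ≺ z
  ≺-trans {x} {y} {z} x∈ x≢z x≺y y≺z with compare x∈ x≢z
  ... | inj₁ balanced   = inj₁ balanced
  ... | inj₂ (inj₁ x≺z) = inj₂ x≺z
  ... | inj₂ (inj₂ z≺x) = contradiction (begin-strict
      3 * N                                     ≡⟨ cong (3 *_) (countBefore-total x∈ x≢z) ⟨
      3 * (countBefore x z ws + czx)            ≤⟨ *-monoʳ-≤ 3 (+-monoʳ-≤ (countBefore x z ws) triangle) ⟩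
      3 * (countBefore x z ws + (cyx + czy))    ≡⟨ e (countBefore x z ws) cyx czy ⟩
      3 * countBefore x z ws + (3 * cyx + 3 * czy) <⟨ +-mono-< z≺x (+-mono-< x≺y y≺z) ⟩
      N + (N + N)                               ≡⟨ e′ N ⟩
      3 * N                                     ∎) (<-irrefl refl)
    where
    open ≤-Reasoning
    cyx = countBefore y x ws
    czy = countBefore z y ws
    czx = countBefore z x ws
    e : ∀ p q s → 3 * (p + (q + s)) ≡ 3 * p + (3 * q + 3 * s)
    e = solve-∀
    e′ : ∀ p → p + (p + p) ≡ 3 * p
    e′ = solve-∀
    triangle : czx ≤ cyx + czy
    triangle = begin
      czx ≡⟨ countBefore≡∑ z x ws ⟩
      ∑ (ind ∘ precedes z x) ws ≤⟨ ∑-mono ws (λ {w} _ → precedes-triangle w x≢z) ⟩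
      ∑ (λ w → ind (precedes y x w) + ind (precedes z y w)) ws ≡⟨ ∑-+ _ _ ws ⟩
      ∑ (ind ∘ precedes y x) ws + ∑ (ind ∘ precedes z y) ws
        ≡⟨ cong₂ _+_ (countBefore≡∑ y x ws) (countBefore≡∑ z y ws) ⟨
      cyx + czy ∎

  -- A search for the maximum under `≺`: the head is compared with the last element of the rest, and
  -- if the head comes later, `≺-trans` carries the bound over to it. Where a comparison fails, it
  -- has found a balanced pair.
  extractLast : ∀ x xs → Unique (x ∷ xs) → All Movable (x ∷ xs) →
    MovableBalancedPair ⊎ ∃ λ b → ∃ λ ys → x ∷ xs ↭ b ∷ ys × All (_≺ b) ys
  extractLast x [] _ _ = inj₂ (x , [] , ↭-refl , [])
  extractLast x (y ∷ xs) u@(_ ∷ uxs) (mx ∷ mxs) with extractLast y xs uxs mxs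
  ... | inj₁ balanced = inj₁ balanced
  ... | inj₂ (b , ys , p , ys≺b) with ux′ ← Unique-resp-↭ (prep x p) u | mb ∷ mys ← All-resp-↭ p mxs
      with x≢b ← (λ { refl → Unique[x∷xs]⇒x∉xs ux′ (here refl) }) with compare (proj₁ mx) x≢b
  ...   | inj₁ balanced   = inj₁ (x , b , mx , mb , x≢b , balanced)
  ...   | inj₂ (inj₁ x≺b) = inj₂ (b , x ∷ ys , ↭-trans (prep x p) (swap x b ↭-refl) , x≺b ∷ ys≺b)
  ...   | inj₂ (inj₂ b≺x) with all≺x (λ { z∈ refl → Unique[x∷xs]⇒x∉xs ux′ (there z∈) }) mys ys≺b
    where
    all≺x : ∀ {zs} → (∀ {z} → z ∈ zs → z ≢ x) → All Movable zs → All (_≺ b) zs → MovableBalancedPair ⊎ All (_≺ x) zs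
    all≺x ≢x [] [] = inj₂ []
    all≺x ≢x (mz ∷ mzs) (z≺b ∷ zs≺b) with ≺-trans (proj₁ mz) (≢x (here refl)) z≺b b≺x | all≺x (≢x ∘ there) mzs zs≺b
    ... | inj₁ balanced | _ = inj₁ (_ , x , mz , mx , ≢x (here refl) , balanced)
    ... | inj₂ _ | inj₁ balanced = inj₁ balanced
    ... | inj₂ z≺x | inj₂ zs≺x = inj₂ (z≺x ∷ zs≺x)
  ...     | inj₁ balanced = inj₁ balanced
  ...     | inj₂ ys≺x     = inj₂ (x , b ∷ ys , prep x p , b≺x ∷ ys≺x)

  -- Positions of two movable letters.

  module _ {a b : Letter} (ma : Movable a) (mb : Movable b) (b≢a : b ≢ a) where

    -- Exchanging `b` with its predecessor lowers its position by one and keeps the order of all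
    -- other letters. This is `lower` for the position of `b`, with π as the class.
    move-b : ∀ {w} → w ∈ ws → index b w ≡ 0 ⊎ ∃ λ w′ → w′ ∈ ws × later b w′ ≡ w ×
             suc (index b w′) ≡ index b w × indexWithout b a w′ ≡ indexWithout b a w
    move-b w∈ with ∈-∃++ (proj₁ mb w∈)
    ... | u , v , refl with b∉u ← Unique-++∷⇒∉ u (uw w∈) with initLast u
    ...   | []       = inj₁ (index-++ [] b∉u)
    ...   | u′ ∷ʳ′ z with index-w ← index-++ (u′ ∷ʳ z) {v} b∉u rewrite ∷ʳ-++ u′ z (b ∷ v) = inj₂
      ( u′ ++ b ∷ z ∷ v , proj₂ mb u′ z v w∈ , later-++ u′ (b∉u ∘ ∈-++⁺ˡ)
      , trans (cong suc (index-++ u′ (b∉u ∘ ∈-++⁺ˡ)))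
              (sym (trans index-w (trans (length-++ u′) (+-comm _ 1))))
      , indexWithout-swap b≢a u′ z v )

    indexWithout-drop : ∀ u {v v′} → a ∉ u → indexWithout b a v ≡ 1 → indexWithout b a v′ ≡ 0 →
                        suc (indexWithout b a (u ++ v′)) ≡ indexWithout b a (u ++ v)
    indexWithout-drop u {v} {v′} a∉u v≡1 v′≡0 = begin
      suc (indexWithout b a (u ++ v′))    ≡⟨ cong suc (indexWithout-++ u v′ a∉u) ⟩
      suc (i + indexWithout b a v′)       ≡⟨ +-suc i _ ⟨
      i + suc (indexWithout b a v′)       ≡⟨ cong (i +_) (trans (cong suc v′≡0) (sym v≡1)) ⟩
      i + indexWithout b a v              ≡⟨ indexWithout-++ u v a∉u ⟨
      indexWithout b a (u ++ v)           ∎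
      where
      open ≡-Reasoning
      i = indexWithout b a (u ++ [ a ])

    -- The last factor is the constancy of the trivial class function λ _ → 0.
    Lowered : Word → Set
    Lowered w = ∃ λ w′ → w′ ∈ ws × laterWithout b a w′ ≡ w ×
                suc (indexWithout b a w′) ≡ indexWithout b a w × 0 ≡ 0

    move-adjacent : ∀ u {z v} → (u ++ z ∷ a ∷ v) ∈ ws → z ≢ b → Lowered (u ++ z ∷ a ∷ v)
    move-adjacent u {z} {v} w∈ z≢b =
        u ++ a ∷ z ∷ v , proj₂ ma u z v w∈
      , trans (laterWithout-++ u (z ∷ v) a∉u) (cong (u ++_) (hop-adjacent v z≢b))
      , indexWithout-drop u a∉u
          (trans (indexWithout-tail (a ∷ v) z≢a z≢b) (cong suc (indexWithout-head b a v)))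
          (indexWithout-head b a (z ∷ v))
      , refl
      where
      uaz = Unique-resp-↭ (++⁺ˡ u (swap z a ↭-refl)) (uw w∈)
      a∉u = Unique-++∷⇒∉ u uaz
      z≢a : z ≢ a
      z≢a refl = Unique-++∷⇒∉ (u ∷ʳ a) (subst Unique (sym (∷ʳ-++ u a (a ∷ v))) (uw w∈)) (∈-++⁺ʳ u (here refl))

    -- Three exchanges lead from z b a through z a b and a z b to a b z. Stopping at a z b would
    -- collide with the image of z a b under `move-adjacent`; returning `b` to its place keeps the
    -- move injective.
    move-across : ∀ u {z v} → (u ++ z ∷ b ∷ a ∷ v) ∈ ws → Lowered (u ++ z ∷ b ∷ a ∷ v)
    move-across u {z} {v} w∈ =
        u ++ a ∷ b ∷ z ∷ v , w′∈
      , trans (laterWithout-++ u (b ∷ z ∷ v) a∉u) (cong (u ++_) (hop-across b a z v))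
      , indexWithout-drop u a∉u
          (trans (indexWithout-tail (b ∷ a ∷ v) z≢a z≢b)
            (cong suc (trans (indexWithout-skip (a ∷ v) b≢a) (indexWithout-head b a v))))
          (indexWithout-head b a (b ∷ z ∷ v))
      , refl
      where
      ∷ʳ∈ : ∀ {x w} → (u ++ x ∷ w) ∈ ws → ((u ∷ʳ x) ++ w) ∈ ws
      ∷ʳ∈ {x} {w} = subst (_∈ ws) (sym (∷ʳ-++ u x w))
      ∈∷ʳ : ∀ {x w} → ((u ∷ʳ x) ++ w) ∈ ws → (u ++ x ∷ w) ∈ ws
      ∈∷ʳ {x} {w} = subst (_∈ ws) (∷ʳ-++ u x w)
      zab∈ = ∈∷ʳ (proj₂ ma (u ∷ʳ z) b v (∷ʳ∈ w∈))
      azb∈ = proj₂ ma u z (b ∷ v) zab∈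
      w′∈ : (u ++ a ∷ b ∷ z ∷ v) ∈ ws
      w′∈ = ∈∷ʳ (proj₂ mb (u ∷ʳ a) z v (∷ʳ∈ azb∈))
      a∉u : a ∉ u
      a∉u = Unique-++∷⇒∉ u (uw w′∈)
      z≢a : z ≢ a
      z≢a refl = Unique-++∷⇒∉ (u ∷ʳ a) (uw (∷ʳ∈ azb∈)) (∈-++⁺ʳ u (here refl))
      z≢b : z ≢ b
      z≢b refl = Unique-++∷⇒∉ (u ∷ʳ b) (uw (∷ʳ∈ w∈)) (∈-++⁺ʳ u (here refl))

    move-a : ∀ {w} → w ∈ ws → indexWithout b a w ≡ 0 ⊎ Lowered w
    move-a w∈ with ∈-∃++ (proj₁ ma w∈)
    ... | u , v , refl with initLast u
    ...   | []       = inj₁ (indexWithout-head b a v)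
    ...   | u′ ∷ʳ′ z rewrite ∷ʳ-++ u′ z (a ∷ v) with z ≟ b
    ...     | no z≢b   = inj₂ (move-adjacent u′ w∈ z≢b)
    ...     | yes refl with initLast u′
    -- Only `b` stands before `a`, and `indexWithout` ignores it.
    ...       | []         = inj₁ (trans (indexWithout-skip (a ∷ v) b≢a) (indexWithout-head b a v))
    ...       | u″ ∷ʳ′ z′ rewrite ∷ʳ-++ u″ z′ (z ∷ a ∷ v) = inj₂ (move-across u″ w∈)

    -- This is Pr[b < a] ≥ E[π + 1] / K without denominators. For fixed π, the position of `b` is a
    -- mixture of uniform distributions on initial segments of at most K places, and in each of them
    -- a proportion of at least (π + 1) / K lies before `a`, by `cumul-threshold`.
    ∑-index≤countBefore : N + ∑ (indexWithout b a) ws ≤ K * countBefore b a ws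
    ∑-index≤countBefore = begin
      N + ∑ (indexWithout b a) ws
        ≡⟨ cong (_+ ∑ (indexWithout b a) ws) (∑-length ws) ⟨
      ∑ (λ _ → 1) ws + ∑ (indexWithout b a) ws
        ≡⟨ ∑-+ _ _ ws ⟨
      ∑ (suc ∘ indexWithout b a) ws
        ≤⟨ Abel.∑-by-parts ws uws (index b) (indexWithout b a) (later b) move-b
             (λ p _ → suc p) (λ p s → K * ind (s <ᵇ suc p)) cumul≤ ⟩
      ∑ (λ w → K * ind (index b w <ᵇ suc (indexWithout b a w))) ws
        ≡⟨ ∑-cong ws (λ {w} w∈ → cong (λ c → K * ind c) (precedes≡index< w (≢-sym b≢a) (proj₁ mb w∈))) ⟨
      ∑ (λ w → K * ind (precedes b a w)) ws
        ≡⟨ ∑-* K _ ws ⟩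
      K * ∑ (ind ∘ precedes b a) ws
        ≡⟨ cong (K *_) (countBefore≡∑ b a ws) ⟨
      K * countBefore b a ws ∎
      where
      open ≤-Reasoning
      cumul≤ : ∀ {w} → w ∈ ws → let p = suc (indexWithout b a w) in
        cumul (λ _ → p) (suc (index b w)) ≤ cumul (λ s → K * ind (s <ᵇ p)) (suc (index b w))
      cumul≤ {w} w∈ = ≤-trans (≤-reflexive (cumul-const (suc (indexWithout b a w)) (suc (index b w))))
        (cumul-threshold K _ _
          (subst (suc (indexWithout b a w) ≤_) (len w∈) (indexWithout<length (proj₁ ma w∈)))
          (subst (suc (index b w) ≤_) (len w∈) (index<length (proj₁ mb w∈))))

    -- All words form a single class here: π itself is a mixture of uniform distributions on initial
    -- segments, and `ψ r` averages at least `φ r` on each.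
    ∑-φ≤∑-ψ : ∀ r → N * φ r ≤ 9 * (r + 1) * ∑ (λ w → r ∸ indexWithout b a w) ws + 4 * r * ∑ (indexWithout b a) ws
    ∑-φ≤∑-ψ r = begin
      N * φ r           ≡⟨ ∑-const (φ r) ws ⟨
      ∑ (λ _ → φ r) ws  ≤⟨ Abel.∑-by-parts ws uws (indexWithout b a) (λ _ → 0) (laterWithout b a) move-a
                             (λ _ _ → φ r) (λ _ → ψ r) (λ {w} _ → φ≤cumul-ψ r (suc (indexWithout b a w))) ⟩
      ∑ (λ w → ψ r (indexWithout b a w)) ws
        ≡⟨ ∑-+ _ _ ws ⟩
      ∑ (λ w → 9 * (r + 1) * (r ∸ indexWithout b a w)) ws + ∑ (λ w → 4 * r * indexWithout b a w) ws
        ≡⟨ cong₂ _+_ (∑-* (9 * (r + 1)) _ ws) (∑-* (4 * r) _ ws) ⟩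
      9 * (r + 1) * ∑ (λ w → r ∸ indexWithout b a w) ws + 4 * r * ∑ (indexWithout b a) ws ∎
      where open ≤-Reasoning

    -- In each word the truncated difference is at most the number of letters of `xs` after `a`.
    -- Exchanging the two sums leaves the counts of `a` before `x`, each below N / 3.
    ∑-∸≤ : ∀ {xs} → Unique xs → b ∉ xs → All (_≺ a) xs →
            3 * ∑ (λ w → length xs ∸ indexWithout b a w) ws ≤ length xs * N
    ∑-∸≤ {xs} uxs b∉ xs≺a = begin
      3 * ∑ (λ w → length xs ∸ indexWithout b a w) ws
        ≤⟨ *-monoʳ-≤ 3 (∑-mono ws λ {w} w∈ → m≤n+o⇒m∸n≤o _ (indexWithout b a w)
             (≤-trans (length≤after+indexWithout w uxs b≢a b∉ (proj₁ ma w∈)) (≤-reflexive (+-comm _ (indexWithout b a w))))) ⟩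
      3 * ∑ (λ w → ∑ (λ x → ind (precedes a x w)) xs) ws
        ≡⟨ cong (3 *_) (∑-comm _ ws xs) ⟩
      3 * ∑ (λ x → ∑ (ind ∘ precedes a x) ws) xs
        ≡⟨ ∑-* 3 _ xs ⟨
      ∑ (λ x → 3 * ∑ (ind ∘ precedes a x) ws) xs
        ≡⟨ ∑-cong xs (λ {x} _ → cong (3 *_) (countBefore≡∑ a x ws)) ⟨
      ∑ (λ x → 3 * countBefore a x ws) xs
        ≤⟨ ∑-mono xs (λ x∈ → <⇒≤ (All.lookup xs≺a x∈)) ⟩
      ∑ (λ _ → N) xs
        ≡⟨ ∑-const N xs ⟩
      length xs * N ∎
      where open ≤-Reasoning

  -- `extractLast` is applied twice, giving b and then a among the rest. The r letters that remain
  -- all satisfy `_≺ a`, so the estimates for a and b contradict each other.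
  movable⇒balanced : ∀ xs r → length xs ≡ 2 + r → Unique xs → All Movable xs →
                     K ≤ 3 ⊎ (1 ≤ r × K ≤ 2 * r + 4) → MovableBalancedPair
  movable⇒balanced (x ∷ y ∷ zs) r len≡ u m K≤ with extractLast x (y ∷ zs) u m
  ... | inj₁ balanced = balanced
  ... | inj₂ (b , [] , p , _) = contradiction (↭-length p) (λ ())
  ... | inj₂ (b , y′ ∷ ys , p , ys≺b)
      with ub@(_ ∷ uys) ← Unique-resp-↭ p u | mb ∷ mys ← All-resp-↭ p m
      with extractLast y′ ys uys mys
  ...   | inj₁ balanced = balanced
  ...   | inj₂ (a , rest , q , rest≺a)
      with _ ∷ urest ← Unique-resp-↭ q uys | ma ∷ _ ← All-resp-↭ q mys
         | a≺b ∷ _ ← All-resp-↭ q ys≺b | b∉ ← (Unique[x∷xs]⇒x∉xs ub ∘ ∈-resp-↭ (↭-sym q))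
      with refl ← suc-injective (suc-injective (trans (sym (↭-length (↭-trans p (prep b q)))) len≡)) =
    ⊥-elim (unbalanced-absurd N K (countBefore b a ws) r _ _
      (∑-index≤countBefore ma mb b≢a) a≺b
      (∑-∸≤ ma mb b≢a urest (b∉ ∘ there) rest≺a) (∑-φ≤∑-ψ ma mb b≢a r) K≤)
    where
    b≢a : b ≢ a
    b≢a refl = b∉ (here refl)

-- Reversed words

module _ {n : ℕ} where

  private
    Letter = Fin n
    Word = List Letter

  precedes-++ˡ : {x y : Letter} (u v : Word) → x ∈ u ⊎ y ∈ u → precedes x y (u ++ v) ≡ precedes x y u
  precedes-++ˡ [] v (inj₁ ())
  precedes-++ˡ [] v (inj₂ ())
  precedes-++ˡ {x} {y} (z ∷ u) v ∈u with z ≟ x | z ≟ y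
  ... | yes _  | _      = refl
  ... | no _   | yes _  = refl
  ... | no z≢x | no z≢y = precedes-++ˡ u v (tail ∈u)
    where
    tail : x ∈ z ∷ u ⊎ y ∈ z ∷ u → x ∈ u ⊎ y ∈ u
    tail (inj₁ (here x≡z)) = contradiction (sym x≡z) z≢x
    tail (inj₁ (there x∈)) = inj₁ x∈
    tail (inj₂ (here y≡z)) = contradiction (sym y≡z) z≢y
    tail (inj₂ (there y∈)) = inj₂ y∈

  precedes-∉ˡ : {x y : Letter} (u : Word) → x ∉ u → precedes x y u ≡ false
  precedes-∉ˡ [] _ = refl
  precedes-∉ˡ {x} {y} (z ∷ u) x∉ with z ≟ x | z ≟ y
  ... | yes z≡x | _     = contradiction (here (sym z≡x)) x∉
  ... | no _    | yes _ = refl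
  ... | no _    | no _  = precedes-∉ˡ u (x∉ ∘ there)

  precedes-∉ʳ : {x y : Letter} (u : Word) → x ∈ u → y ∉ u → precedes x y u ≡ true
  precedes-∉ʳ {x} {y} (z ∷ u) x∈ y∉ with z ≟ x | z ≟ y
  ... | yes _ | _       = refl
  ... | no _  | yes z≡y = contradiction (here (sym z≡y)) y∉
  precedes-∉ʳ (z ∷ u) (here x≡z) y∉ | no z≢x | no _ = contradiction (sym x≡z) z≢x
  precedes-∉ʳ (z ∷ u) (there x∈) y∉ | no _   | no _ = precedes-∉ʳ u x∈ (y∉ ∘ there)

  ∈-reverse : {x : Letter} {w : Word} → x ∈ w → x ∈ reverse w
  ∈-reverse {w = w} = ∈-resp-↭ (↭-sym (↭-reverse w))

  ∈-reverse⁻ : {x : Letter} {w : Word} → x ∈ reverse w → x ∈ w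
  ∈-reverse⁻ {w = w} = ∈-resp-↭ (↭-reverse w)

  precedes-reverse : {x y : Letter} (w : Word) → Unique w → x ≢ y → x ∈ w → y ∈ w →
                     precedes x y (reverse w) ≡ precedes y x w
  precedes-reverse {x} {y} (z ∷ w) u@(_ ∷ uw) x≢y x∈ y∈ rewrite unfold-reverse z w = helper x∈ y∈
    where
    helper : x ∈ z ∷ w → y ∈ z ∷ w → precedes x y (reverse w ++ [ z ]) ≡ precedes y x (z ∷ w)
    helper (here refl) (here refl) = contradiction refl x≢y
    helper (here refl) (there y∈w) = begin
      precedes x y (reverse w ++ [ z ]) ≡⟨ precedes-++ˡ (reverse w) [ z ] (inj₂ (∈-reverse y∈w)) ⟩
      precedes x y (reverse w)          ≡⟨ precedes-∉ˡ (reverse w) (Unique[x∷xs]⇒x∉xs u ∘ ∈-reverse⁻) ⟩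
      false                             ≡⟨ precedes-head′ w (≢-sym x≢y) ⟨
      precedes y x (z ∷ w)              ∎
      where open ≡-Reasoning
    helper (there x∈w) (here refl) = begin
      precedes x y (reverse w ++ [ z ]) ≡⟨ precedes-++ˡ (reverse w) [ z ] (inj₁ (∈-reverse x∈w)) ⟩
      precedes x y (reverse w)          ≡⟨ precedes-∉ʳ (reverse w) (∈-reverse x∈w) (Unique[x∷xs]⇒x∉xs u ∘ ∈-reverse⁻) ⟩
      true                              ≡⟨ precedes-head y x w ⟨
      precedes y x (z ∷ w)              ∎
      where open ≡-Reasoning
    helper (there x∈w) (there y∈w) = begin
      precedes x y (reverse w ++ [ z ]) ≡⟨ precedes-++ˡ (reverse w) [ z ] (inj₁ (∈-reverse x∈w)) ⟩
      precedes x y (reverse w)          ≡⟨ precedes-reverse w uw x≢y x∈w y∈w ⟩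
      precedes y x w                    ≡⟨ precedes-tail {z = z} w (λ { refl → Unique[x∷xs]⇒x∉xs u y∈w })
                                                           (λ { refl → Unique[x∷xs]⇒x∉xs u x∈w }) ⟨
      precedes y x (z ∷ w)              ∎
      where open ≡-Reasoning

  countBefore-reverse : {x y : Letter} (ws : List Word) → x ≢ y →
    (∀ {w} → w ∈ ws → Unique w × x ∈ w × y ∈ w) → countBefore x y (map reverse ws) ≡ countBefore y x ws
  countBefore-reverse {x} {y} ws x≢y h = begin
    countBefore x y (map reverse ws)              ≡⟨ countBefore≡∑ x y (map reverse ws) ⟩
    sum (map (ind ∘ precedes x y) (map reverse ws)) ≡⟨ cong sum (map-∘ ws) ⟨
    ∑ (ind ∘ precedes x y ∘ reverse) ws
      ≡⟨ ∑-cong ws (λ {w} w∈ → let u , x∈ , y∈ = h w∈ in cong ind (precedes-reverse w u x≢y x∈ y∈)) ⟩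
    ∑ (ind ∘ precedes y x) ws                     ≡⟨ countBefore≡∑ y x ws ⟨
    countBefore y x ws                            ∎
    where open ≡-Reasoning

-- Feasible sets and basic words

x∉p-x : ∀ {n} (x : Fin n) (p : Subset n) → x ∉ₛ p - x
x∉p-x Fin.zero    (_ ∷ᵥ p) ()
x∉p-x (Fin.suc x) (_ ∷ᵥ p) (thereᵥ x∈) = x∉p-x x p x∈

module Antimatroid {n : ℕ} (𝒜 : Family n) (anti : IsAntimatroid 𝒜) where

  private
    Letter = Fin n
    ⟦_⟧ = setOf 𝒜

  Minimal : Letter → Set
  Minimal x = Feasible 𝒜 ⁅ x ⁆

  minimal? : ∀ x → Dec (Minimal x)
  minimal? x = 𝒜 ⁅ x ⁆ Bool.≟ true

  feasible? : ∀ S → Dec (Feasible 𝒜 S)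
  feasible? S = 𝒜 S Bool.≟ true

  ∪-feasible = proj₁ anti
  accessible = proj₂ anti

  feasible-resp : ∀ {S T} → S ⊆ T → T ⊆ S → Feasible 𝒜 S → Feasible 𝒜 T
  feasible-resp S⊆T T⊆S = subst (Feasible 𝒜) (⊆-antisym S⊆T T⊆S)

  ∈⟦⟧⁺ : ∀ {x u} → x ∈ u → x ∈ₛ ⟦ u ⟧
  ∈⟦⟧⁺ (here refl) = x∈p∪q⁺ (inj₁ (x∈⁅x⁆ _))
  ∈⟦⟧⁺ (there x∈u) = x∈p∪q⁺ (inj₂ (∈⟦⟧⁺ x∈u))

  ∈⟦⟧⁻ : ∀ {x} u → x ∈ₛ ⟦ u ⟧ → x ∈ u
  ∈⟦⟧⁻ []      x∈ = contradiction x∈ ∉⊥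
  ∈⟦⟧⁻ (y ∷ u) x∈ with x∈p∪q⁻ ⁅ y ⁆ ⟦ u ⟧ x∈
  ... | inj₁ x∈y = here (x∈⁅y⁆⇒x≡y y x∈y)
  ... | inj₂ x∈u = there (∈⟦⟧⁻ u x∈u)

  ⟦⟧-resp-↭ : ∀ {u v} → u ↭ v → Feasible 𝒜 ⟦ u ⟧ → Feasible 𝒜 ⟦ v ⟧
  ⟦⟧-resp-↭ {u} {v} p = feasible-resp (∈⟦⟧⁺ ∘ ∈-resp-↭ p ∘ ∈⟦⟧⁻ u) (∈⟦⟧⁺ ∘ ∈-resp-↭ (↭-sym p) ∘ ∈⟦⟧⁻ v)

  -- Accessibility removes one element after another; in the opposite order, the removed elements
  -- form the word.
  wordOf : ∀ S → Feasible 𝒜 S → ∃ λ u → Unique u × ⟦ u ⟧ ≡ S × PrefixesFeasible 𝒜 u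
  wordOf S = go S (<-wellFounded ∣ S ∣)
    where
    go : ∀ S → Acc _<_ ∣ S ∣ → Feasible 𝒜 S → ∃ λ u → Unique u × ⟦ u ⟧ ≡ S × PrefixesFeasible 𝒜 u
    go S (acc rec) fS with nonempty? S
    ... | no ∅ rewrite Empty-unique ∅ = [] , [] , refl , λ { [] [] _ → fS }
    ... | yes ne with accessible S fS ne
    ...   | x , x∈S , fS-x with go (S - x) (rec (x∈p⇒∣p-x∣<∣p∣ x∈S)) fS-x
    ...     | u , uu , set-u , pf = u ∷ʳ x , uux , set≡ , prefixes
      where
      x∉u : x ∉ u
      x∉u x∈u = x∉p-x x S (subst (x ∈ₛ_) set-u (∈⟦⟧⁺ x∈u))
      uux : Unique (u ∷ʳ x)
      uux = Unique-resp-↭ (++-comm [ x ] u) (All.¬Any⇒All¬ u x∉u ∷ uu)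
      set≡ : ⟦ u ∷ʳ x ⟧ ≡ S
      set≡ = ⊆-antisym to from
        where
        to : ⟦ u ∷ʳ x ⟧ ⊆ S
        to y∈ with ∈-++⁻ u (∈⟦⟧⁻ (u ∷ʳ x) y∈)
        ... | inj₁ y∈u = p─q⊆p S ⁅ x ⁆ (subst (_ ∈ₛ_) set-u (∈⟦⟧⁺ y∈u))
        ... | inj₂ (here refl) = x∈S
        from : S ⊆ ⟦ u ∷ʳ x ⟧
        from {y} y∈ with y ≟ x
        ... | yes refl = ∈⟦⟧⁺ (∈-++⁺ʳ u (here refl))
        ... | no y≢x = ∈⟦⟧⁺ (∈-++⁺ˡ (∈⟦⟧⁻ u (subst (y ∈ₛ_) (sym set-u) (x∈p∧x≢y⇒x∈p-y y∈ y≢x))))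
      prefixes : PrefixesFeasible 𝒜 (u ∷ʳ x)
      prefixes u′ v′ eq with initLast v′
      ... | [] rewrite ++-identityʳ u′ | eq = subst (Feasible 𝒜) (sym set≡) fS
      ... | v″ ∷ʳ′ y = pf u′ v″ (proj₁ (∷ʳ-injective (u′ ++ v″) u (trans (++-assoc u′ v″ [ y ]) eq)))

  ⊥-feasible : ∀ {S} → Feasible 𝒜 S → Feasible 𝒜 ⊥ₛ
  ⊥-feasible {S} fS = let u , _ , _ , pf = wordOf S fS in pf [] u refl

  element? : ∀ x → Dec (Element 𝒜 x)
  element? x = anySubset? (λ S → feasible? S ×-dec (x ∈? S))

  ground : ∀ {S} → Feasible 𝒜 S → ∃ λ U → Feasible 𝒜 U × (∀ x → Element 𝒜 x → x ∈ₛ U)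
  ground {S} fS = let U , fU , h = go (allFin n) in U , fU , λ x → h (∈-allFin x)
    where
    go : ∀ xs → ∃ λ U → Feasible 𝒜 U × (∀ {x} → x ∈ xs → Element 𝒜 x → x ∈ₛ U)
    -- The union starts from the given `S`, because closure under binary unions provides no feasible
    -- set to begin with.
    go [] = S , fS , λ ()
    go (x ∷ xs) with go xs | element? x
    ... | U , fU , h | no ¬el = U , fU , λ { (here refl) el → contradiction el ¬el ; (there x∈) → h x∈ }
    ... | U , fU , h | yes (T , fT , x∈T) = U ∪ T , ∪-feasible U T fU fT ,
      λ { (here refl) _ → x∈p∪q⁺ (inj₂ x∈T) ; (there x∈) el → x∈p∪q⁺ (inj₁ (h x∈ el)) }

  basicWord : ∀ {S} → Feasible 𝒜 S → ∃ (IsBasicWord 𝒜)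
  basicWord fS with ground fS
  ... | U , fU , h with wordOf U fU
  ...   | u , uu , refl , pf = u , uu ,
          (λ x → mk⇔ (λ x∈u → ⟦ u ⟧ , fU , ∈⟦⟧⁺ x∈u) (λ el → ∈⟦⟧⁻ u (h x el))) , pf

  head-minimal : ∀ {x u} → PrefixesFeasible 𝒜 (x ∷ u) → Minimal x
  head-minimal {x} {u} pf = subst (Feasible 𝒜) (∪-identityʳ ⁅ x ⁆) (pf [ x ] u refl)

  -- An exchange of neighbours alters the underlying set of one prefix only, the one that ends
  -- between them; no other prefix needs a new proof of feasibility.
  prefix-swap : ∀ u {x z : Letter} {v} u′ v′ → u′ ++ v′ ≡ u ++ x ∷ z ∷ v →
    u′ ≡ u ∷ʳ x ⊎ ∃ λ u″ → ∃ λ v″ → u″ ++ v″ ≡ u ++ z ∷ x ∷ v × u″ ↭ u′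
  prefix-swap u [] v′ eq = inj₂ ([] , _ , refl , ↭-refl)
  prefix-swap [] (x ∷ []) v′ refl = inj₁ refl
  prefix-swap [] (x ∷ z ∷ u′) v′ refl = inj₂ (z ∷ x ∷ u′ , v′ , refl , swap z x ↭-refl)
  prefix-swap (y ∷ u) (y′ ∷ u′) v′ eq with refl , eq′ ← ∷-injective eq with prefix-swap u u′ v′ eq′
  ... | inj₁ e = inj₁ (cong (y ∷_) e)
  ... | inj₂ (u″ , v″ , e , p) = inj₂ (y ∷ u″ , v″ , cong (y ∷_) e , prep y p)

  swap-basic : ∀ u {z x v} → IsBasicWord 𝒜 (u ++ z ∷ x ∷ v) → Feasible 𝒜 ⟦ u ∷ʳ x ⟧ →
               IsBasicWord 𝒜 (u ++ x ∷ z ∷ v)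
  swap-basic u {z} {x} {v} (uniq , elem , pf) fux =
      Unique-resp-↭ p uniq
    , (λ y → mk⇔ (Equivalence.to (elem y) ∘ ∈-resp-↭ (↭-sym p)) (∈-resp-↭ p ∘ Equivalence.from (elem y)))
    , prefixes
    where
    p : u ++ z ∷ x ∷ v ↭ u ++ x ∷ z ∷ v
    p = ++⁺ˡ u (swap z x ↭-refl)
    prefixes : PrefixesFeasible 𝒜 (u ++ x ∷ z ∷ v)
    prefixes u′ v′ eq with prefix-swap u u′ v′ eq
    ... | inj₁ refl = fux
    ... | inj₂ (u″ , v″ , e , q) = ⟦⟧-resp-↭ q (pf u″ v″ e)

  -- The new prefix is the union of two feasible sets, that of `u` and the singleton of `x`.
  minimal-earlier : ∀ u {z x v} → Minimal x → IsBasicWord 𝒜 (u ++ z ∷ x ∷ v) → IsBasicWord 𝒜 (u ++ x ∷ z ∷ v)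
  minimal-earlier u {z} {x} {v} mx bw@(_ , _ , pf) =
    swap-basic u bw (⟦⟧-resp-↭ (++-comm [ x ] u) (∪-feasible _ _ mx (pf u _ refl)))

  -- Elements other than `z` are discarded as long as the set stays feasible. When none can be,
  -- accessibility still yields a removable element, which must then be `z`, so a path with endpoint
  -- `z` is left.
  path-to : ∀ S {z} → Feasible 𝒜 S → z ∈ₛ S →
    ∃ λ P → P ⊆ S × z ∈ₛ P × IsPath 𝒜 P × (∀ y → y ∈ₛ P → Feasible 𝒜 (P - y) → y ≡ z)
  path-to S = go S (<-wellFounded ∣ S ∣)
    where
    go : ∀ S {z} → Acc _<_ ∣ S ∣ → Feasible 𝒜 S → z ∈ₛ S →
      ∃ λ P → P ⊆ S × z ∈ₛ P × IsPath 𝒜 P × (∀ y → y ∈ₛ P → Feasible 𝒜 (P - y) → y ≡ z)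
    go S {z} (acc rec) fS z∈S with any? (λ y → (y ∈? S) ×-dec ¬? (y ≟ z) ×-dec feasible? (S - y))
    ... | yes (y , y∈S , y≢z , fS-y) =
      let P , P⊆ , rest = go (S - y) (rec (x∈p⇒∣p-x∣<∣p∣ y∈S)) fS-y (x∈p∧x≢y⇒x∈p-y z∈S (≢-sym y≢z))
      in P , (λ x∈ → p─q⊆p S ⁅ y ⁆ (P⊆ x∈)) , rest
    ... | no none = S , id , z∈S , isPath , endpoint
      where
      endpoint : ∀ y → y ∈ₛ S → Feasible 𝒜 (S - y) → y ≡ z
      endpoint y y∈S fS-y with y ≟ z
      ... | yes y≡z = y≡z
      ... | no y≢z = contradiction (y , y∈S , y≢z , fS-y) none
      isPath : IsPath 𝒜 S
      isPath with accessible S fS (z , z∈S)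
      ... | x , x∈S , fS-x with refl ← endpoint x x∈S fS-x = fS , z , z∈S , fS-x , endpoint

  singleton-path : ∀ {x} → Minimal x → IsPath 𝒜 ⁅ x ⁆
  singleton-path {x} mx = mx , x , x∈⁅x⁆ x ,
    feasible-resp (λ y∈ → contradiction y∈ ∉⊥)
      (λ y∈ → contradiction (subst (_∈ₛ ⁅ x ⁆ - x) (x∈⁅y⁆⇒x≡y x (p─q⊆p ⁅ x ⁆ ⁅ x ⁆ y∈)) y∈) (x∉p-x x ⁅ x ⁆))
      (⊥-feasible mx) ,
    λ y y∈ _ → x∈⁅y⁆⇒x≡y x y∈

  -- A feasible ordering of `S` begins with a minimal element.
  minimal-in : ∀ {S t} → Feasible 𝒜 S → t ∈ₛ S → ∃ λ s → s ∈ₛ S × Minimal s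
  minimal-in {S} fS t∈S with wordOf S fS
  ... | []    , _ , refl , pf = contradiction t∈S ∉⊥
  ... | s ∷ u , _ , refl , pf = s , ∈⟦⟧⁺ {u = s ∷ u} (here refl) , head-minimal pf

  -- Consequences of height at most two.

  module HeightTwo (height : HeightAtMostTwo 𝒜) where

    -- A non-minimal t in P other than the endpoint z would give a chain {s} ⊂ Q ⊂ P of paths.
    support : ∀ S {z} → Feasible 𝒜 S → z ∈ₛ S →
      ∃ λ P → P ⊆ S × z ∈ₛ P × Feasible 𝒜 P × (∀ {t} → t ∈ₛ P → t ≢ z → Minimal t)
    support S {z} fS z∈S with path-to S fS z∈S
    ... | P , P⊆S , z∈P , isP@(fP , z′ , z′∈P , fP-z′ , _) , endpoint
        with refl ← endpoint z′ z′∈P fP-z′ = P , P⊆S , z∈P , fP , minimal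
      where
      minimal : ∀ {t} → t ∈ₛ P → t ≢ z → Minimal t
      minimal {t} t∈P t≢z with minimal? t
      ... | yes mt = mt
      ... | no ¬mt with path-to (P - z) fP-z′ (x∈p∧x≢y⇒x∈p-y t∈P t≢z)
      ...   | Q , Q⊆P-z , t∈Q , isQ@(fQ , _) , _ with minimal-in fQ t∈Q
      ...     | s , s∈Q , ms = ⊥-elim (height ⁅ s ⁆ Q P (singleton-path ms) isQ isP
                  ((λ x∈ → subst (_∈ₛ Q) (sym (x∈⁅y⁆⇒x≡y s x∈)) s∈Q) , t , t∈Q ,
                    λ t∈s → ¬mt (subst Minimal (sym (x∈⁅y⁆⇒x≡y s t∈s)) ms))
                  ((λ x∈ → p─q⊆p P ⁅ z ⁆ (Q⊆P-z x∈)) , z , z∈P , x∉p-x z P ∘ Q⊆P-z))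

    -- By `support`, `z` lies in a feasible subset of `S` whose other members are minimal and hence
    -- occur in `u`. Its union with the set of `u` therefore adds at most `z`.
    extend-feasible : ∀ u {S z} → Feasible 𝒜 ⟦ u ⟧ → Feasible 𝒜 S → z ∈ₛ S →
      (∀ {t} → t ∈ₛ S → t ≢ z → Minimal t → t ∈ u) → Feasible 𝒜 ⟦ u ∷ʳ z ⟧
    extend-feasible u {S} {z} fu fS z∈S minimal∈u with support S fS z∈S
    ... | P , P⊆S , z∈P , fP , minimal = feasible-resp to from (∪-feasible ⟦ u ⟧ P fu fP)
      where
      to : ⟦ u ⟧ ∪ P ⊆ ⟦ u ∷ʳ z ⟧
      to {t} t∈ with x∈p∪q⁻ ⟦ u ⟧ P t∈
      ... | inj₁ t∈u = ∈⟦⟧⁺ (∈-++⁺ˡ (∈⟦⟧⁻ u t∈u))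
      ... | inj₂ t∈P with t ≟ z
      ...   | yes refl = ∈⟦⟧⁺ (∈-++⁺ʳ u (here refl))
      ...   | no t≢z   = ∈⟦⟧⁺ (∈-++⁺ˡ (minimal∈u (P⊆S t∈P) t≢z (minimal t∈P t≢z)))
      from : ⟦ u ∷ʳ z ⟧ ⊆ ⟦ u ⟧ ∪ P
      from {t} t∈ with ∈-++⁻ u (∈⟦⟧⁻ (u ∷ʳ z) t∈)
      ... | inj₁ t∈u = x∈p∪q⁺ (inj₁ (∈⟦⟧⁺ t∈u))
      ... | inj₂ (here refl) = x∈p∪q⁺ (inj₂ z∈P)

    -- The set of `u`, `y` and `z` is feasible, and since `y` is not minimal, its minimal members
    -- other than `z` all lie in `u`. So `z` can be added without waiting for `y`.
    nonminimal-later : ∀ u {y z v} → ¬ Minimal y → IsBasicWord 𝒜 (u ++ y ∷ z ∷ v) → IsBasicWord 𝒜 (u ++ z ∷ y ∷ v)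
    nonminimal-later u {y} {z} {v} ¬my bw@(_ , _ , pf) =
      swap-basic u bw (extend-feasible u (pf u _ refl)
        (pf (u ++ y ∷ z ∷ []) v (++-assoc u (y ∷ z ∷ []) v)) (∈⟦⟧⁺ (∈-++⁺ʳ u (there (here refl)))) minimal∈u)
      where
      minimal∈u : ∀ {t} → t ∈ₛ ⟦ u ++ y ∷ z ∷ [] ⟧ → t ≢ z → Minimal t → t ∈ u
      minimal∈u t∈ t≢z mt with ∈-++⁻ u (∈⟦⟧⁻ (u ++ y ∷ z ∷ []) t∈)
      ... | inj₁ t∈u = t∈u
      ... | inj₂ (here refl) = contradiction mt ¬my
      ... | inj₂ (there (here t≡z)) = contradiction t≡z t≢z

-- Two minimal and two non-minimal elements

-- Inclusion and exclusion for β and δ, whose complements are α and γ; equality holds in all four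
-- cases.
indicator-sum : ∀ α β γ δ → ind α + ind β ≡ 1 → ind γ + ind δ ≡ 1 →
                1 + ind (β ∧ δ) ≤ ind (α ∧ γ) + (ind β + ind δ)
indicator-sum true  false true  false _ _ = ≤-refl
indicator-sum true  false false true  _ _ = ≤-refl
indicator-sum false true  true  false _ _ = ≤-refl
indicator-sum false true  false true  _ _ = ≤-refl

module FourLetters {n : ℕ} (ws : List (List (Fin n))) (uws : Unique ws) {a b y y′ : Fin n}
  (uniq : Unique (a ∷ b ∷ y ∷ y′ ∷ []))
  (perm : ∀ {w} → w ∈ ws → w ↭ a ∷ b ∷ y ∷ y′ ∷ [])
  (heads : ∀ {x w} → (x ∷ w) ∈ ws → x ≡ a ⊎ x ≡ b)
  (bayy′∈ : (b ∷ a ∷ y ∷ y′ ∷ []) ∈ ws) (bay′y∈ : (b ∷ a ∷ y′ ∷ y ∷ []) ∈ ws) where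

  private
    Letter = Fin n
    Word = List Letter

    a≢b : a ≢ b
    a≢b refl = Unique[x∷xs]⇒x∉xs uniq (here refl)
    a≢y : a ≢ y
    a≢y refl = Unique[x∷xs]⇒x∉xs uniq (there (here refl))
    a≢y′ : a ≢ y′
    a≢y′ refl = Unique[x∷xs]⇒x∉xs uniq (there (there (here refl)))
    b≢y : b ≢ y
    b≢y refl = Unique[x∷xs]⇒x∉xs (AllPairs.tail uniq) (here refl)
    b≢y′ : b ≢ y′
    b≢y′ refl = Unique[x∷xs]⇒x∉xs (AllPairs.tail uniq) (there (here refl))
    y≢y′ : y ≢ y′
    y≢y′ refl = Unique[x∷xs]⇒x∉xs (AllPairs.tail (AllPairs.tail uniq)) (here refl)

  -- The candidates with a before b and y before y′: by `heads` such a word starts with `a`, and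
  -- then `b` has three places relative to `y` and `y′`.
  orders : List Word
  orders = (a ∷ b ∷ y ∷ y′ ∷ []) ∷ (a ∷ y ∷ b ∷ y′ ∷ []) ∷ (a ∷ y ∷ y′ ∷ b ∷ []) ∷ []

  false≢true : ∀ {c} {A : Set} → c ≡ true → c ≡ false → A
  false≢true refl ()

  classify₂ : ∀ w → w ↭ y ∷ y′ ∷ [] → precedes y y′ w ≡ true → w ≡ y ∷ y′ ∷ []
  classify₂ [] p _ = contradiction (↭-length p) (λ ())
  classify₂ (x ∷ w) p pr with ∈-resp-↭ p (here refl)
  ... | here refl         = cong (y ∷_) (↭-singleton-inv (drop-∷ p))
  ... | there (here refl) = false≢true pr (precedes-head′ w y≢y′)

  classify₃ : ∀ w → w ↭ b ∷ y ∷ y′ ∷ [] → precedes y y′ w ≡ true → (a ∷ w) ∈ orders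
  classify₃ [] p _ = contradiction (↭-length p) (λ ())
  classify₃ (x ∷ w) p pr with ∈-resp-↭ p (here refl)
  ... | here refl = here (cong (λ v → a ∷ b ∷ v)
                      (classify₂ w (drop-∷ p) (trans (sym (precedes-tail w b≢y b≢y′)) pr)))
  ... | there (there (here refl)) = false≢true pr (precedes-head′ w y≢y′)
  ... | there (here refl) with w | drop-∷ (↭-trans p (swap b y ↭-refl))
  ...   | []    | q = contradiction (↭-length q) (λ ())
  ...   | z ∷ v | q with ∈-resp-↭ q (here refl)
  ...     | here refl = there (here (cong (λ v → a ∷ y ∷ b ∷ v) (↭-singleton-inv (drop-∷ q))))
  ...     | there (here refl) = there (there (here (cong (λ v → a ∷ y ∷ y′ ∷ v)
              (↭-singleton-inv (drop-∷ (↭-trans q (swap b y′ ↭-refl)))))))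

  classify₄ : ∀ {w} → w ∈ ws → precedes a b w ≡ true → precedes y y′ w ≡ true → w ∈ orders
  classify₄ {[]} w∈ _ _ = contradiction (↭-length (perm w∈)) (λ ())
  classify₄ {x ∷ w} w∈ pab pyy′ with heads w∈
  ... | inj₁ refl = classify₃ w (drop-∷ (perm w∈)) (trans (sym (precedes-tail w a≢y a≢y′)) pyy′)
  ... | inj₂ refl = false≢true pab (precedes-head′ w a≢b)

  ∑-orders≤3 : ∑ (λ w → ind (precedes a b w ∧ precedes y y′ w)) ws ≤ 3
  ∑-orders≤3 = ∑-injection _ (λ _ → 1) id ws orders uws inOrders
    where
    inOrders : ∀ {w} → w ∈ ws → ind (precedes a b w ∧ precedes y y′ w) ≡ 0 ⊎
               ∃ λ v → v ∈ orders × v ≡ w × ind (precedes a b w ∧ precedes y y′ w) ≤ 1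
    inOrders {w} w∈ with precedes a b w in pab | precedes y y′ w in pyy′
    ... | true  | true  = inj₂ (w , classify₄ w∈ pab pyy′ , refl , ≤-refl)
    ... | true  | false = inj₁ refl
    ... | false | _     = inj₁ refl

  2≤countBefore : 2 ≤ countBefore b a ws
  2≤countBefore = subst (2 ≤_) (sym (countBefore≡∑ b a ws))
    (∑-injection (λ _ → 1) (ind ∘ precedes b a) id ((b ∷ a ∷ y ∷ y′ ∷ []) ∷ (b ∷ a ∷ y′ ∷ y ∷ []) ∷ []) ws
      (((λ { refl → y≢y′ refl }) ∷ []) ∷ [] ∷ []) λ
      { (here refl)         → inj₂ (_ , bayy′∈ , refl , ≤-reflexive (cong ind (sym (precedes-head b a _))))
      ; (there (here refl)) → inj₂ (_ , bay′y∈ , refl , ≤-reflexive (cong ind (sym (precedes-head b a _)))) })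

  1≤both : 1 ≤ ∑ (λ w → ind (precedes b a w ∧ precedes y′ y w)) ws
  1≤both = ∑-injection (λ _ → 1) _ id ((b ∷ a ∷ y′ ∷ y ∷ []) ∷ []) ws ([] ∷ [])
    λ { (here refl) → inj₂ (_ , bay′y∈ , refl , ≤-reflexive (cong ind (sym both))) }
    where
    both : precedes b a (b ∷ a ∷ y′ ∷ y ∷ []) ∧ precedes y′ y (b ∷ a ∷ y′ ∷ y ∷ []) ≡ true
    both = cong₂ _∧_ (precedes-head b a _)
      (trans (precedes-tail {z = b} _ b≢y′ b≢y) (trans (precedes-tail {z = a} _ a≢y′ a≢y) (precedes-head y′ y _)))

  -- Apart from at most three, each word has b before a or y′ before y; the word b a y′ y has both.
  not-both-small : 3 * countBefore b a ws < length ws → 3 * countBefore y′ y ws < length ws → ⊥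
  not-both-small v<N v′<N = <-irrefl refl (begin-strict
      -- `total`, `v<N` and `v′<N` together force N ≤ 4, against `7≤N`, which holds because at least
      -- two words have `b` before `a`.
      2 * N + 9             <⟨ +-monoʳ-< (2 * N) {9} {12} (s≤s (m≤m+n 9 2)) ⟩
      2 * N + 12            ≤⟨ +-monoʳ-≤ (2 * N) (+-monoˡ-≤ 5 7≤N) ⟩
      2 * N + (N + 5)       ≡⟨ e₁ N ⟩
      3 * (N + 1) + 2       ≤⟨ +-monoˡ-≤ 2 (*-monoʳ-≤ 3 total) ⟩
      3 * (3 + (v + v′)) + 2 ≡⟨ e₂ v v′ ⟩
      suc (3 * v) + suc (3 * v′) + 9 ≤⟨ +-monoˡ-≤ 9 (+-mono-≤ v<N v′<N) ⟩
      N + N + 9             ≡⟨ e₃ N ⟩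
      2 * N + 9             ∎)
    where
    open ≤-Reasoning
    N = length ws
    v = countBefore b a ws
    v′ = countBefore y′ y ws
    e₁ : ∀ N → 2 * N + (N + 5) ≡ 3 * (N + 1) + 2
    e₁ = solve-∀
    e₂ : ∀ v v′ → 3 * (3 + (v + v′)) + 2 ≡ suc (3 * v) + suc (3 * v′) + 9
    e₂ = solve-∀
    e₃ : ∀ N → N + N + 9 ≡ 2 * N + 9
    e₃ = solve-∀
    7≤N : 7 ≤ N
    7≤N = ≤-trans (s≤s (*-monoʳ-≤ 3 2≤countBefore)) v<N
    present : ∀ {x w} → w ∈ ws → x ∈ a ∷ b ∷ y ∷ y′ ∷ [] → x ∈ w
    present w∈ = ∈-resp-↭ (↭-sym (perm w∈))
    total : N + 1 ≤ 3 + (v + v′)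
    total = begin
      N + 1
        ≤⟨ +-monoʳ-≤ N 1≤both ⟩
      N + ∑ (λ w → ind (precedes b a w ∧ precedes y′ y w)) ws
        ≡⟨ cong (_+ ∑ (λ w → ind (precedes b a w ∧ precedes y′ y w)) ws) (∑-length ws) ⟨
      ∑ (λ _ → 1) ws + ∑ (λ w → ind (precedes b a w ∧ precedes y′ y w)) ws
        ≡⟨ ∑-+ _ _ ws ⟨
      ∑ (λ w → 1 + ind (precedes b a w ∧ precedes y′ y w)) ws
        ≤⟨ ∑-mono ws (λ {w} w∈ → indicator-sum (precedes a b w) (precedes b a w) (precedes y y′ w) (precedes y′ y w)
             (precedes-total w a≢b (present w∈ (here refl)))
             (precedes-total w y≢y′ (present w∈ (there (there (here refl)))))) ⟩
      ∑ (λ w → ind (precedes a b w ∧ precedes y y′ w) + (ind (precedes b a w) + ind (precedes y′ y w))) ws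
        ≡⟨ trans (∑-+ _ _ ws) (cong (∑ (λ w → ind (precedes a b w ∧ precedes y y′ w)) ws +_) (∑-+ _ _ ws)) ⟩
      ∑ (λ w → ind (precedes a b w ∧ precedes y y′ w)) ws + (∑ (ind ∘ precedes b a) ws + ∑ (ind ∘ precedes y′ y) ws)
        ≡⟨ cong (∑ (λ w → ind (precedes a b w ∧ precedes y y′ w)) ws +_)
             (cong₂ _+_ (countBefore≡∑ b a ws) (countBefore≡∑ y′ y ws)) ⟨
      ∑ (λ w → ind (precedes a b w ∧ precedes y y′ w)) ws + (v + v′)
        ≤⟨ +-monoˡ-≤ (v + v′) ∑-orders≤3 ⟩
      3 + (v + v′) ∎

-- Filtering and short lists.

filter-↭-++ : {A : Set} {P : A → Set} (P? : ∀ x → Dec (P x)) (xs : List A) →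
              xs ↭ filter P? xs ++ filter (¬? ∘ P?) xs
filter-↭-++ P? [] = ↭-refl
filter-↭-++ P? (x ∷ xs) with P? x
... | yes _ = prep x (filter-↭-++ P? xs)
... | no _  = ↭-trans (prep x (filter-↭-++ P? xs)) (↭-sym (shift x (filter P? xs) (filter (¬? ∘ P?) xs)))

constant⇒singleton : {A : Set} {x : A} {xs : List A} → Unique xs → x ∈ xs → (∀ {y} → y ∈ xs → y ≡ x) → xs ≡ [ x ]
constant⇒singleton {xs = y ∷ []} _ _ ≡x = cong [_] (≡x (here refl))
constant⇒singleton {xs = y ∷ z ∷ xs} u _ ≡x =
  contradiction (here (trans (≡x (here refl)) (sym (≡x (there (here refl)))))) (Unique[x∷xs]⇒x∉xs u)

∈⇒length≢0 : {A : Set} {x : A} {xs : List A} → x ∈ xs → length xs ≢ 0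
∈⇒length≢0 (here _)  ()
∈⇒length≢0 (there _) ()

length≡1⇒≡ : {A : Set} {x y : A} {xs : List A} → length xs ≡ 1 → x ∈ xs → y ∈ xs → x ≡ y
length≡1⇒≡ {xs = _ ∷ []} _ (here refl) (here refl) = refl

length≡2 : {A : Set} {xs : List A} → length xs ≡ 2 → ∃ λ x → ∃ λ y → xs ≡ x ∷ y ∷ []
length≡2 {xs = x ∷ y ∷ []} _ = x , y , refl

↭-short : {A : Set} (xs ys : List A) → xs ↭ ys → length ys ≤ 1 → xs ≡ ys
↭-short xs []          p _ = ↭-empty-inv p
↭-short xs (y ∷ [])    p _ = ↭-singleton-inv p
↭-short xs (_ ∷ _ ∷ _) p (s≤s ())

-- Case distinction by the numbers of minimal and non-minimal elements.

module Height2 {n : ℕ} (𝒜 : Family n) (anti : IsAntimatroid 𝒜) (height : HeightAtMostTwo 𝒜)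
  (ws : List (List (Fin n))) (enum : EnumeratesBasicWords 𝒜 ws)
  {w₀ : List (Fin n)} (bw₀ : IsBasicWord 𝒜 w₀) where

  open Antimatroid 𝒜 anti
  open HeightTwo height

  private
    Letter = Fin n
    Word = List Letter

    uws : Unique ws
    uws = proj₁ enum

    basic : ∀ {w} → w ∈ ws → IsBasicWord 𝒜 w
    basic {w} = Equivalence.to (proj₂ enum w)

    listed : ∀ {w} → IsBasicWord 𝒜 w → w ∈ ws
    listed {w} = Equivalence.from (proj₂ enum w)

    uw : ∀ {w} → w ∈ ws → Unique w
    uw = proj₁ ∘ basic

  element : ∀ {x} → x ∈ w₀ → Element 𝒜 x
  element {x} = Equivalence.to (proj₁ (proj₂ bw₀) x)

  -- Both words list every element exactly once.
  perm : ∀ {w} → w ∈ ws → w ↭ w₀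
  perm w∈ = ∼bag⇒↭ (unique∧set⇒bag (uw w∈) (proj₁ bw₀)
    (λ {x} → mk⇔ (Equivalence.from (proj₁ (proj₂ bw₀) x) ∘ Equivalence.to (proj₁ (proj₂ (basic w∈)) x))
                 (Equivalence.from (proj₁ (proj₂ (basic w∈)) x) ∘ element)))

  present : ∀ {x} → x ∈ w₀ → ∀ {w} → w ∈ ws → x ∈ w
  present x∈ w∈ = ∈-resp-↭ (↭-sym (perm w∈)) x∈

  mins nonmins : Word
  mins = filter minimal? w₀
  nonmins = filter (¬? ∘ minimal?) w₀

  w₀↭ : w₀ ↭ mins ++ nonmins
  w₀↭ = filter-↭-++ minimal? w₀

  length-w₀ : length w₀ ≡ length mins + length nonmins
  length-w₀ = trans (↭-length w₀↭) (length-++ mins)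

  head∈mins : ∀ {x w} → (x ∷ w) ∈ ws → x ∈ mins
  head∈mins w∈ = ∈-filter⁺ minimal? (∈-resp-↭ (perm w∈) (here refl)) (head-minimal (proj₂ (proj₂ (basic w∈))))

  HasBalancedPair : Set
  HasBalancedPair = ∃ λ x → ∃ λ y → BalancedPair 𝒜 ws x y

  module Fwd = Movable ws uws (length w₀) (↭-length ∘ perm) uw

  mins-balanced : ∀ r → length mins ≡ 2 + r → length w₀ ≤ 3 ⊎ (1 ≤ r × length w₀ ≤ 2 * r + 4) → HasBalancedPair
  mins-balanced r m≡ K≤ =
    let x , y , (x∈ , _) , (y∈ , _) , x≢y , balanced =
          Fwd.movable⇒balanced mins r m≡ (Unique.filter⁺ minimal? (proj₁ bw₀)) (All.tabulate movable) K≤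
    in x , y , element (x∈ (listed bw₀)) , element (y∈ (listed bw₀)) , x≢y , balanced
    where
    movable : ∀ {x} → x ∈ mins → Fwd.Movable x
    movable x∈ with x∈w₀ , mx ← ∈-filter⁻ minimal? x∈ =
      present x∈w₀ , λ u z v w∈ → listed (minimal-earlier u mx (basic w∈))

  private
    rws : List Word
    rws = map reverse ws

    unreverse : ∀ {w} → w ∈ rws → reverse w ∈ ws
    unreverse w∈ with w′ , w′∈ , refl ← ∈-map⁻ reverse w∈ = subst (_∈ ws) (sym (reverse-involutive w′)) w′∈

    reverse-mid : ∀ u (x y : Letter) v → reverse (u ++ x ∷ y ∷ v) ≡ reverse v ++ y ∷ x ∷ reverse u
    reverse-mid u x y v = begin
      reverse (u ++ x ∷ y ∷ v)                ≡⟨ reverse-++ u (x ∷ y ∷ v) ⟩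
      reverse (x ∷ y ∷ v) ++ reverse u        ≡⟨ cong (_++ reverse u) (reverse-++ (x ∷ y ∷ []) v) ⟩
      (reverse v ++ y ∷ x ∷ []) ++ reverse u  ≡⟨ ++-assoc (reverse v) (y ∷ x ∷ []) (reverse u) ⟩
      reverse v ++ y ∷ x ∷ reverse u          ∎
      where open ≡-Reasoning

  module Bwd = Movable rws (Unique.map⁺ reverse-injective uws) (length w₀)
    (λ {w} w∈ → trans (sym (length-reverse w)) (↭-length (perm (unreverse w∈))))
    (λ {w} w∈ → Unique-resp-↭ (↭-reverse w) (uw (unreverse w∈)))

  -- Moving later becomes moving earlier once words are reversed, so the non-minimal elements are
  -- movable for `Bwd`. Reversal also exchanges the two counts of a pair, whence the pair is
  -- returned as `y , x`.
  nonmins-balanced : ∀ r → length nonmins ≡ 2 + r → length w₀ ≤ 3 ⊎ (1 ≤ r × length w₀ ≤ 2 * r + 4) → HasBalancedPair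
  nonmins-balanced r l≡ K≤ =
    let x , y , (x∈ , _) , (y∈ , _) , x≢y , lo , hi =
          Bwd.movable⇒balanced nonmins r l≡ (Unique.filter⁺ (¬? ∘ minimal?) (proj₁ bw₀)) (All.tabulate movable) K≤
        x∈′ = λ {w} w∈ → ∈-reverse⁻ {w = w} (x∈ (∈-map⁺ reverse w∈))
        y∈′ = λ {w} w∈ → ∈-reverse⁻ {w = w} (y∈ (∈-map⁺ reverse w∈))
        count≡ = countBefore-reverse ws x≢y (λ w∈ → uw w∈ , x∈′ w∈ , y∈′ w∈)
    in y , x , element (y∈′ (listed bw₀)) , element (x∈′ (listed bw₀)) , ≢-sym x≢y
     , subst₂ (λ N c → N ≤ 3 * c) (length-map reverse ws) count≡ lo
     , subst₂ (λ N c → 3 * c ≤ 2 * N) (length-map reverse ws) count≡ hi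
    where
    movable : ∀ {x} → x ∈ nonmins → Bwd.Movable x
    movable {x} x∈ with x∈w₀ , ¬mx ← ∈-filter⁻ (¬? ∘ minimal?) {xs = w₀} x∈ =
        (λ {w} w∈ → ∈-reverse⁻ (present x∈w₀ (unreverse w∈)))
      , λ u z v w∈ → subst (_∈ rws) (trans (reverse-mid (reverse v) z x (reverse u))
            (cong₂ (λ u′ v′ → u′ ++ x ∷ z ∷ v′) (reverse-involutive u) (reverse-involutive v)))
          (∈-map⁺ reverse (listed (nonminimal-later (reverse v) ¬mx
            (basic (subst (_∈ ws) (reverse-mid u z x v) (unreverse w∈))))))

  mins-nonempty : ∀ {x w} → w ∈ ws → x ∈ w → length mins ≢ 0
  mins-nonempty {w = y ∷ w} w∈ _ = ∈⇒length≢0 (head∈mins w∈)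

  -- The only minimal element comes first in both words, and at most one letter is left to place.
  single : length mins ≡ 1 → length nonmins ≤ 1 → ∀ {w w′} → w ∈ ws → w′ ∈ ws → w ≡ w′
  single m≡1 l≤1 {[]} {[]} _ _ = refl
  single m≡1 l≤1 {[]} {_ ∷ _} w∈ w′∈ = contradiction (trans (↭-length (perm w∈)) (sym (↭-length (perm w′∈)))) (λ ())
  single m≡1 l≤1 {_ ∷ _} {[]} w∈ w′∈ = contradiction (trans (↭-length (perm w∈)) (sym (↭-length (perm w′∈)))) (λ ())
  single m≡1 l≤1 {x ∷ w} {x′ ∷ w′} w∈ w′∈ with refl ← length≡1⇒≡ m≡1 (head∈mins w∈) (head∈mins w′∈) =
    cong (x ∷_) (↭-short w w′ (drop-∷ (↭-trans (perm w∈) (↭-sym (perm w′∈)))) (subst (_≤ 1) (sym length-w′) l≤1))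
    where
    length-w′ : length w′ ≡ length nonmins
    length-w′ = suc-injective (trans (↭-length (perm w′∈)) (trans length-w₀ (cong (_+ length nonmins) m≡1)))

  -- The critical prefix is the third: as `a` and `b` are all the minimal elements,
  -- `extend-feasible`, applied inside the full set, lets any further element follow them.
  four-basic : ∀ {a b y y′} → w₀ ↭ a ∷ b ∷ y ∷ y′ ∷ [] → Minimal a → Minimal b →
    (∀ {t} → t ∈ w₀ → Minimal t → t ∈ a ∷ b ∷ []) → IsBasicWord 𝒜 (a ∷ b ∷ y ∷ y′ ∷ [])
  four-basic {a} {b} {y} {y′} p ma mb mins∈ =
      Unique-resp-↭ p (proj₁ bw₀)
    , (λ x → mk⇔ (element ∘ ∈-resp-↭ (↭-sym p)) (∈-resp-↭ p ∘ Equivalence.from (proj₁ (proj₂ bw₀) x)))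
    , prefixes
    where
    full : Feasible 𝒜 (setOf 𝒜 w₀)
    full = proj₂ (proj₂ bw₀) w₀ [] (++-identityʳ w₀)
    fb : Feasible 𝒜 (setOf 𝒜 [ b ])
    fb = ∪-feasible _ _ mb (⊥-feasible full)
    fab : Feasible 𝒜 (setOf 𝒜 (a ∷ b ∷ []))
    fab = ∪-feasible _ _ ma fb
    prefixes : PrefixesFeasible 𝒜 (a ∷ b ∷ y ∷ y′ ∷ [])
    prefixes [] _ _ = ⊥-feasible full
    prefixes (_ ∷ []) _ refl = ∪-feasible _ _ ma (⊥-feasible full)
    prefixes (_ ∷ _ ∷ []) _ refl = fab
    prefixes (_ ∷ _ ∷ _ ∷ []) _ refl = extend-feasible (a ∷ b ∷ []) fab full
      (∈⟦⟧⁺ (∈-resp-↭ (↭-sym p) (there (there (here refl))))) (λ t∈ _ → mins∈ (∈⟦⟧⁻ w₀ t∈))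
    prefixes (_ ∷ _ ∷ _ ∷ _ ∷ []) _ refl = ⟦⟧-resp-↭ p full
    prefixes (_ ∷ _ ∷ _ ∷ _ ∷ _ ∷ _) _ ()

  -- After `b` and `a`, the other two letters may follow in either order; these are the two basic
  -- words that `FourLetters` asks for.
  four-absurd : ∀ {a b y y′} → w₀ ↭ a ∷ b ∷ y ∷ y′ ∷ [] → Minimal a → Minimal b →
    (∀ {t} → t ∈ w₀ → Minimal t → t ∈ a ∷ b ∷ []) → a Fwd.≺ b → y Fwd.≺ y′ → ⊥
  four-absurd {a} {b} {y} {y′} p ma mb mins∈ = FourLetters.not-both-small ws uws (Unique-resp-↭ p (proj₁ bw₀))
    (λ w∈ → ↭-trans (perm w∈) p) heads
    (listed (four-basic (↭-trans p (swap a b ↭-refl)) mb ma mins∈′))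
    (listed (four-basic (↭-trans p (swap a b (swap y y′ ↭-refl))) mb ma mins∈′))
    where
    mins∈′ : ∀ {t} → t ∈ w₀ → Minimal t → t ∈ b ∷ a ∷ []
    mins∈′ t∈ mt = ∈-resp-↭ (swap a b ↭-refl) (mins∈ t∈ mt)
    heads : ∀ {x w} → (x ∷ w) ∈ ws → x ≡ a ⊎ x ≡ b
    heads w∈ with x∈ , mx ← ∈-filter⁻ minimal? (head∈mins w∈) with mins∈ x∈ mx
    ... | here x≡a         = inj₁ x≡a
    ... | there (here x≡b) = inj₂ x≡b

  -- If neither the minimal nor the non-minimal pair is balanced, each is relabelled in the order of
  -- `≺`, and `four-absurd` applies.
  two-two-balanced : length mins ≡ 2 → length nonmins ≡ 2 → HasBalancedPair
  two-two-balanced m≡2 l≡2 with length≡2 m≡2 | length≡2 l≡2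
  ... | a , b , M≡ | y , y′ , Y≡ = decide (Fwd.compare (present a∈) a≢b) (Fwd.compare (present y∈) y≢y′)
    where
    p : w₀ ↭ a ∷ b ∷ y ∷ y′ ∷ []
    p = subst₂ (λ M Y → w₀ ↭ M ++ Y) M≡ Y≡ w₀↭
    a∈ : a ∈ w₀
    a∈ = ∈-resp-↭ (↭-sym p) (here refl)
    b∈ : b ∈ w₀
    b∈ = ∈-resp-↭ (↭-sym p) (there (here refl))
    y∈ : y ∈ w₀
    y∈ = ∈-resp-↭ (↭-sym p) (there (there (here refl)))
    y′∈ : y′ ∈ w₀
    y′∈ = ∈-resp-↭ (↭-sym p) (there (there (there (here refl))))
    u : Unique (a ∷ b ∷ y ∷ y′ ∷ [])
    u = Unique-resp-↭ p (proj₁ bw₀)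
    a≢b : a ≢ b
    a≢b refl = Unique[x∷xs]⇒x∉xs u (here refl)
    y≢y′ : y ≢ y′
    y≢y′ refl = Unique[x∷xs]⇒x∉xs (AllPairs.tail (AllPairs.tail u)) (here refl)
    minimal : ∀ {x} → x ∈ a ∷ b ∷ [] → Minimal x
    minimal x∈ = proj₂ (∈-filter⁻ minimal? {xs = w₀} (subst (_ ∈_) (sym M≡) x∈))
    mins∈ : ∀ {t} → t ∈ w₀ → Minimal t → t ∈ a ∷ b ∷ []
    mins∈ t∈ mt = subst (_ ∈_) M≡ (∈-filter⁺ minimal? t∈ mt)
    ma = minimal (here refl)
    mb = minimal (there (here refl))
    mins∈′ : ∀ {t} → t ∈ w₀ → Minimal t → t ∈ b ∷ a ∷ []
    mins∈′ t∈ mt = ∈-resp-↭ (swap a b ↭-refl) (mins∈ t∈ mt)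
    decide : Fwd.Balanced a b ⊎ (a Fwd.≺ b ⊎ b Fwd.≺ a) → Fwd.Balanced y y′ ⊎ (y Fwd.≺ y′ ⊎ y′ Fwd.≺ y) → HasBalancedPair
    decide (inj₁ balanced) _ = a , b , element a∈ , element b∈ , a≢b , balanced
    decide (inj₂ _) (inj₁ balanced) = y , y′ , element y∈ , element y′∈ , y≢y′ , balanced
    decide (inj₂ (inj₁ a≺b)) (inj₂ (inj₁ y≺y′)) = ⊥-elim (four-absurd p ma mb mins∈ a≺b y≺y′)
    decide (inj₂ (inj₁ a≺b)) (inj₂ (inj₂ y′≺y)) =
      ⊥-elim (four-absurd (↭-trans p (prep a (prep b (swap y y′ ↭-refl)))) ma mb mins∈ a≺b y′≺y)
    decide (inj₂ (inj₂ b≺a)) (inj₂ (inj₁ y≺y′)) =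
      ⊥-elim (four-absurd (↭-trans p (swap a b ↭-refl)) mb ma mins∈′ b≺a y≺y′)
    decide (inj₂ (inj₂ b≺a)) (inj₂ (inj₂ y′≺y)) =
      ⊥-elim (four-absurd (↭-trans p (swap a b (swap y y′ ↭-refl))) mb ma mins∈′ b≺a y′≺y)

  length≤ : ∀ {m l k} → length mins ≡ m → length nonmins ≡ l → m + l ≤ k → length w₀ ≤ k
  length≤ refl refl = subst (_≤ _) (sym length-w₀)

  double : ∀ r → (3 + r) + (3 + r) ≡ 2 * suc r + 4
  double = solve-∀

  -- The larger group is used. If it has r + 2 ≥ 3 members, there are at most 2 r + 4 elements in
  -- all. If it has two, there are either at most three elements or two of each kind, the case done
  -- by hand. What remains is one minimal element and at most one other.
  dichotomy : ∀ m l → length mins ≡ m → length nonmins ≡ l → m ≢ 0 → (m ≡ 1 × l ≤ 1) ⊎ HasBalancedPair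
  dichotomy m l m≡ l≡ m≢0 with ≤-total l m
  dichotomy 0 l m≡ l≡ m≢0 | inj₁ l≤m = contradiction refl m≢0
  dichotomy 1 l m≡ l≡ m≢0 | inj₁ l≤m = inj₁ (refl , l≤m)
  dichotomy 2 0 m≡ l≡ m≢0 | inj₁ l≤m = inj₂ (mins-balanced 0 m≡ (inj₁ (length≤ m≡ l≡ (m≤m+n 2 1))))
  dichotomy 2 1 m≡ l≡ m≢0 | inj₁ l≤m = inj₂ (mins-balanced 0 m≡ (inj₁ (length≤ m≡ l≡ ≤-refl)))
  dichotomy 2 2 m≡ l≡ m≢0 | inj₁ l≤m = inj₂ (two-two-balanced m≡ l≡)
  dichotomy 2 (suc (suc (suc _))) m≡ l≡ m≢0 | inj₁ (s≤s (s≤s ()))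
  dichotomy (suc (suc (suc r))) l m≡ l≡ m≢0 | inj₁ l≤m = inj₂ (mins-balanced (suc r) m≡ (inj₂ (s≤s z≤n ,
    length≤ m≡ l≡ (≤-trans (+-monoʳ-≤ (3 + r) l≤m) (≤-reflexive (double r))))))
  dichotomy 0 l m≡ l≡ m≢0 | inj₂ m≤l = contradiction refl m≢0
  dichotomy 1 1 m≡ l≡ m≢0 | inj₂ m≤l = inj₁ (refl , ≤-refl)
  dichotomy 1 2 m≡ l≡ m≢0 | inj₂ m≤l = inj₂ (nonmins-balanced 0 l≡ (inj₁ (length≤ m≡ l≡ ≤-refl)))
  dichotomy 2 2 m≡ l≡ m≢0 | inj₂ m≤l = inj₂ (two-two-balanced m≡ l≡)
  dichotomy (suc (suc _)) 1 m≡ l≡ m≢0 | inj₂ (s≤s ())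
  dichotomy (suc (suc (suc _))) 2 m≡ l≡ m≢0 | inj₂ (s≤s (s≤s ()))
  dichotomy m@(suc _) (suc (suc (suc s))) m≡ l≡ m≢0 | inj₂ m≤l = inj₂ (nonmins-balanced (suc s) l≡ (inj₂ (s≤s z≤n ,
    length≤ m≡ l≡ (≤-trans (+-monoˡ-≤ (3 + s) m≤l) (≤-reflexive (double s))))))

  conclusion : (∃ λ x → x ∈ w₀) →
    (Σ Word λ w → ws ≡ w ∷ [] × (length w ≡ 1 ⊎ length w ≡ 2)) ⊎ HasBalancedPair
  conclusion (x , x∈) with dichotomy _ _ refl refl (mins-nonempty (listed bw₀) x∈)
  ... | inj₂ balanced = inj₂ balanced
  ... | inj₁ (m≡1 , l≤1) = inj₁
    ( w₀ , constant⇒singleton uws (listed bw₀) (λ w∈ → single m≡1 l≤1 w∈ (listed bw₀))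
    , subst (λ k → k ≡ 1 ⊎ k ≡ 2) (sym (trans length-w₀ (cong (_+ length nonmins) m≡1))) (short l≤1) )
    where
    short : ∀ {l} → l ≤ 1 → suc l ≡ 1 ⊎ suc l ≡ 2
    short z≤n       = inj₁ refl
    short (s≤s z≤n) = inj₂ refl

theorem5 : {n : ℕ} (𝒜 : Family n) → IsAntimatroid 𝒜 → HeightAtMostTwo 𝒜 →
    (∃ λ x → Element 𝒜 x) →
    (ws : List (List (Fin n))) → EnumeratesBasicWords 𝒜 ws →
    (Σ (List (Fin n)) λ w → ws ≡ w ∷ [] × (length w ≡ 1 ⊎ length w ≡ 2))
    ⊎ (∃ λ x → ∃ λ y → BalancedPair 𝒜 ws x y)
theorem5 𝒜 anti height (x , el@(_ , fS , _)) ws enum with Antimatroid.basicWord 𝒜 anti fS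
... | w₀ , bw₀@(_ , elements , _) =
  Height2.conclusion 𝒜 anti height ws enum bw₀ (x , Equivalence.from (elements x) el)
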